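{- Let $k\ge 2$ be an integer. Let $G$ be a finite simple graph that is $k$-connected and is a $[k+1,2]$-graph. Then $G$ is hamiltonian-connected unless $G$ is isomorphic to $kK_1\vee G_k$ for some graph $G_k$ of order $k$.
   Context: For integers $s,t$, a graph $G$ is an $[s,t]$-graph if every induced subgraph of $G$ on $s$ vertices has at least $t$ edges. A graph is hamiltonian-connected if for any two distinct vertices $x,y$ there is a path with endpoints $x$ and $y$ containing every vertex of the graph. $kK_1$ denotes the edgeless graph on $k$ vertices, and for graphs $G,H$, the join $G\vee H$ is obtained from the disjoint union of $G$ and $H$ by adding all edges between a vertex of $G$ and a vertex of $H$. $G_k$ is an arbitrary graph on $k$ vertices. -}

module Defs where

open import Data.Nat using (ℕ; _+_; _<_; _≤_; _<ᵇ_)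
open import Data.Bool using (Bool; true; false; _∧_; if_then_else_)
open import Data.Fin using (Fin; toℕ; splitAt)
open import Data.Fin.Subset using (Subset; _∈_; _∉_; ∣_∣)
open import Data.Fin.Subset using () renaming (_∈_ to _∈ₛ_)
open import Data.Vec using (lookup)
open import Data.Sum using (_⊎_; inj₁; inj₂)
open import Data.Product using (Σ; _×_; _,_; proj₁; proj₂; ∃)
open import Data.List using (List; []; _∷_; length; filterᵇ; cartesianProduct; allFin)
open import Data.List.Relation.Unary.All using (All)
open import Data.List.Relation.Unary.Unique.Propositional using (Unique)
import Data.List.Membership.Propositional as LM
open import Relation.Binary.PropositionalEquality using (_≡_; refl)
open import Relation.Nullary using (¬_)
open import Function.Bundles using (_↔_; Inverse)

record Graph (n : ℕ) : Set where
  field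
    adj    : Fin n → Fin n → Bool
    sym    : ∀ u v → adj u v ≡ adj v u
    irrefl : ∀ v → adj v v ≡ false
open Graph public

module _ {n : ℕ} (G : Graph n) where

  data Walk : Fin n → Fin n → List (Fin n) → Set where
    here : ∀ x → Walk x x (x ∷ [])
    step : ∀ {x y z vs} → adj G x y ≡ true → Walk y z vs → Walk x z (x ∷ vs)

  ConnectedWithout : Subset n → Set
  ConnectedWithout S = ∀ u v → u ∉ S → v ∉ S →
    ∃ λ vs → Walk u v vs × All (λ w → w ∉ S) vs

  KConnected : ℕ → Set
  KConnected k = k < n × (∀ (S : Subset n) → ∣ S ∣ < k → ConnectedWithout S)

  inS : Subset n → Fin n → Bool
  inS S v = lookup S v

  edgesIn : Subset n → ℕ
  edgesIn S = length (filterᵇ (λ p → (toℕ (proj₁ p) <ᵇ toℕ (proj₂ p)) ∧ (inS S (proj₁ p) ∧ (inS S (proj₂ p) ∧ adj G (proj₁ p) (proj₂ p))))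
                               (cartesianProduct (allFin n) (allFin n)))

  STGraph : ℕ → ℕ → Set
  STGraph s t = ∀ (S : Subset n) → ∣ S ∣ ≡ s → t ≤ edgesIn S

  HamiltonianPath : Fin n → Fin n → Set
  HamiltonianPath x y = ∃ λ vs → Walk x y vs × Unique vs × (∀ v → v LM.∈ vs)

  HamiltonianConnected : Set
  HamiltonianConnected = ∀ x y → ¬ (x ≡ y) → HamiltonianPath x y

_≅_ : ∀ {n m} → Graph n → Graph m → Set
_≅_ {n} {m} G H = Σ (Fin n ↔ Fin m) λ f →
  ∀ u v → adj G u v ≡ adj H (Inverse.to f u) (Inverse.to f v)

-- kK₁ ∨ H for a graph H on k vertices; vertices Fin (k + k):
-- the first k form the independent set kK₁, the last k carry H.
joinAdj : ∀ {k} → Graph k → Fin (k + k) → Fin (k + k) → Bool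
joinAdj {k} H u v with splitAt k u | splitAt k v
... | inj₁ _ | inj₁ _ = false
... | inj₁ _ | inj₂ _ = true
... | inj₂ _ | inj₁ _ = true
... | inj₂ a | inj₂ b = adj H a b

joinSym : ∀ {k} (H : Graph k) u v → joinAdj H u v ≡ joinAdj H v u
joinSym {k} H u v with splitAt k u | splitAt k v
... | inj₁ _ | inj₁ _ = refl
... | inj₁ _ | inj₂ _ = refl
... | inj₂ _ | inj₁ _ = refl
... | inj₂ a | inj₂ b = sym H a b

joinIrrefl : ∀ {k} (H : Graph k) v → joinAdj H v v ≡ false
joinIrrefl {k} H v with splitAt k v
... | inj₁ _ = refl
... | inj₂ a = irrefl H a

join-kK1 : ∀ k → Graph k → Graph (k + k)
join-kK1 k H = record { adj = joinAdj H ; sym = joinSym H ; irrefl = joinIrrefl H }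

{-# OPTIONS --safe #-}
-- Suppose that there is no Hamiltonian x–y path, and let P be a longest x–y path, h a vertex off P and C
-- its component in G − P. By k-connectivity at least k vertices of P are attached to C, and the
-- successors on P of the attached vertices, together with h, form an independent set S. As an independent
-- set has at most k vertices, |S| = k and both x and y are attached. A vertex outside S has two
-- neighbours in S, and this forces h to be the only vertex off P.
--
-- Cut P after each neighbour of h into blocks v ∷ B with heads v, so that S consists of h and the heads.
-- Rerouting shows that along a block the neighbours in S move strictly backwards in a cyclic order of S.
-- Each s ∈ S is itself the vertex missed by some path on all other vertices, hence has at least k
-- neighbours and is adjacent to x; therefore it has exactly one neighbour in each block, and the
-- next-to-last element of the cyclic order is adjacent to the first vertex of B. Exchanging h for such
-- heads gives paths in which more and more initial blocks have |B| = 1. Once all blocks do, S is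
-- completely joined to the remaining k vertices.
--
-- The argument by contradiction is sound constructively because being a join is decidable.

module Submission where

open import Defs
open import Data.Nat using (ℕ; zero; suc; _+_; _≤_; _<_; z≤n; s≤s; s≤s⁻¹; _<ᵇ_)
open import Data.Nat.Properties hiding (_≟_)
open import Data.Bool using (Bool; true; false; _∧_)
import Data.Bool.Properties as Bool
open import Data.Fin using (Fin; zero; suc; toℕ; splitAt)
import Data.Fin as Fin
open import Data.Fin.Properties using (_≟_; any?; all?; join-splitAt; splitAt-join)
open import Data.Fin.Subset using (Subset; ⊥; inside; ∣_∣)
open import Data.Fin.Subset.Properties using (∉⊥; ∣⊥∣≡0)
open import Data.Vec using ([]; _∷_; lookup; _[_]≔_)
open import Data.Vec.Properties using (lookup⇒[]=; lookup∘update; lookup∘update′; lookup-replicate; []=⇒lookup)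
open import Data.Sum using (_⊎_; inj₁; inj₂; [_,_]′; map₁; map₂)
open import Data.Product using (∃; ∃₂; _×_; _,_; proj₁; proj₂)
open import Data.Empty using (⊥-elim) renaming (⊥ to False)
open import Data.List using (List; []; _∷_; [_]; _++_; _∷ʳ_; length; map; filter; initLast; _∷ʳ′_; reverse; allFin; cartesianProduct)
import Data.List as List
open import Data.List.Properties using (length-take; take++drop≡id; ++-assoc; ++-identityʳ; length-++; unfold-reverse; reverse-++; length-reverse; length-map; map-∘; map-++; filter-++; length-tabulate)
open import Data.List.Membership.Propositional using (_∈_; _∉_)
open import Data.List.Membership.Propositional.Properties using (∈-++⁺ˡ; ∈-++⁺ʳ; ∈-++⁻; ∈-∃++; ∈-insert; ∈-filter⁺; ∈-filter⁻; ∈-allFin; ∈-lookup; ∈-map⁺; ∈-map⁻)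
open import Data.List.Membership.DecPropositional using () renaming (_∈?_ to member?)
open import Data.List.Relation.Unary.Any using (here; there; index)
open import Data.List.Relation.Unary.Any.Properties using (lookup-index)
open import Data.List.Relation.Unary.All as All using (All; []; _∷_)
open import Data.List.Relation.Unary.All.Properties using (++⁻ˡ; ¬Any⇒All¬)
  renaming (++⁺ to All-++⁺)
open import Data.List.Relation.Unary.AllPairs as AllPairs using (AllPairs; []; _∷_)
open import Data.List.Relation.Unary.Linked using (Linked; []; [-]; _∷_)
open import Data.List.Relation.Unary.Linked.Properties using (Linked⇒AllPairs)
open import Data.List.Relation.Unary.Unique.Propositional using (Unique)
open import Data.List.Relation.Unary.Unique.Propositional.Properties using (allFin⁺; cartesianProduct⁺; Unique[x∷xs]⇒x∉xs)
  renaming (++⁺ to Unique-++⁺; filter⁺ to Unique-filter; take⁺ to Unique-take)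
open import Data.List.Relation.Unary.Unique.DecPropositional using (unique?)
open import Data.List.Relation.Binary.Permutation.Propositional using (_↭_; ↭-swap; ↭-refl; ↭-sym; ↭-trans; ↭-reflexive; prep; ↭⇒↭ₛ)
open import Data.List.Relation.Binary.Permutation.Propositional.Properties
  using (∈-resp-↭; ↭-length; ↭-reverse; filter-↭; shift; ++-commutativeMonoid)
  renaming (++⁺ to ↭-++⁺; ++⁺ˡ to ↭-++⁺ˡ; ++⁺ʳ to ↭-++⁺ʳ)
import Data.List.Relation.Binary.Permutation.Setoid.Properties as Permutationₛ
import Algebra.Solver.CommutativeMonoid as Solver
open import Function using (_∘_; id; case_of_)
open import Function.Bundles using (_↔_; mk↔ₛ′; Equivalence)
open import Relation.Binary.PropositionalEquality using (_≡_; _≢_; refl; trans; cong; cong₂; subst; module ≡-Reasoning)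
  renaming (sym to ≡-sym; setoid to ≡-setoid)
open import Relation.Nullary using (¬_; Dec; yes; no; contradiction)
open import Relation.Nullary.Decidable using (decidable-stable; _×-dec_; ¬?; map′)
open import Relation.Unary using (Decidable)

private variable
  A : Set
  n : ℕ

-- Lists without repetition and the pigeonhole principle.

Unique-resp-↭ : {xs ys : List A} → xs ↭ ys → Unique xs → Unique ys
Unique-resp-↭ {A} p = Permutationₛ.Unique-resp-↭ (≡-setoid A) (↭⇒↭ₛ p)

unique-++⁻ˡ : (xs : List A) {ys : List A} → Unique (xs ++ ys) → Unique xs
unique-++⁻ˡ []       _        = []
unique-++⁻ˡ (x ∷ xs) (p ∷ u) = ++⁻ˡ xs p ∷ unique-++⁻ˡ xs u

unique-++⁻ʳ : (xs : List A) {ys : List A} → Unique (xs ++ ys) → Unique ys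
unique-++⁻ʳ []       u       = u
unique-++⁻ʳ (x ∷ xs) (_ ∷ u) = unique-++⁻ʳ xs u

unique-++-disjoint : ∀ (xs : List A) {ys x} → Unique (xs ++ ys) → x ∈ xs → x ∉ ys
unique-++-disjoint (x ∷ xs) u       (here refl) y∈ = Unique[x∷xs]⇒x∉xs u (∈-++⁺ʳ xs y∈)
unique-++-disjoint (x ∷ xs) (_ ∷ u) (there x∈)  y∈ = unique-++-disjoint xs u x∈ y∈

∉∷⇒≢ : {x y : A} {xs : List A} → Unique (x ∷ xs) → y ∈ xs → x ≢ y
∉∷⇒≢ u y∈ refl = Unique[x∷xs]⇒x∉xs u y∈

two-members : {xs : List A} → Unique xs → 2 ≤ length xs → ∃₂ λ x y → x ∈ xs × y ∈ xs × x ≢ y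
two-members {xs = x ∷ []}     u (s≤s ())
two-members {xs = x ∷ y ∷ _} u _ = x , y , here refl , there (here refl) , ∉∷⇒≢ u (here refl)

unique-⊆-length : {xs ys : List A} → Unique xs → (∀ {x} → x ∈ xs → x ∈ ys) → length xs ≤ length ys
unique-⊆-length {xs = []}     _ _ = z≤n
unique-⊆-length {xs = x ∷ xs} u xs⊆ys with ∈-∃++ (xs⊆ys (here refl))
... | as , bs , refl = ≤-trans (s≤s (unique-⊆-length (unique-++⁻ʳ [ x ] u) xs⊆))
                         (≤-reflexive (≡-sym (↭-length (shift x as bs))))
  where
  xs⊆ : ∀ {y} → y ∈ xs → y ∈ as ++ bs
  xs⊆ y∈ with ∈-++⁻ as (xs⊆ys (there y∈))
  ... | inj₁ y∈as         = ∈-++⁺ˡ y∈as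
  ... | inj₂ (here y≡x)   = contradiction (≡-sym y≡x) (∉∷⇒≢ u y∈)
  ... | inj₂ (there y∈bs) = ∈-++⁺ʳ as y∈bs

unique-⊇⇒↭ : {xs ys : List A} → Unique xs → (∀ {x} → x ∈ xs → x ∈ ys) → length ys ≤ length xs → xs ↭ ys
unique-⊇⇒↭ {xs = []}     {[]} _ _ _ = ↭-refl
unique-⊇⇒↭ {xs = x ∷ xs} {ys} u xs⊆ys ≤xs with ∈-∃++ (xs⊆ys (here refl))
... | as , bs , refl = ↭-trans (prep x (unique-⊇⇒↭ (unique-++⁻ʳ [ x ] u) xs⊆
                         (s≤s⁻¹ (≤-trans (≤-reflexive (≡-sym (↭-length (shift x as bs)))) ≤xs))))
                         (↭-sym (shift x as bs))
  where
  xs⊆ : ∀ {y} → y ∈ xs → y ∈ as ++ bs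
  xs⊆ y∈ with ∈-++⁻ as (xs⊆ys (there y∈))
  ... | inj₁ y∈as         = ∈-++⁺ˡ y∈as
  ... | inj₂ (here y≡x)   = contradiction (≡-sym y≡x) (∉∷⇒≢ u y∈)
  ... | inj₂ (there y∈bs) = ∈-++⁺ʳ as y∈bs

length-allFin : length (allFin n) ≡ n
length-allFin {n} = length-tabulate (λ (i : Fin n) → i)

unique-length≤ : {xs : List (Fin n)} → Unique xs → length xs ≤ n
unique-length≤ u = ≤-trans (unique-⊆-length u (λ _ → ∈-allFin _)) (≤-reflexive length-allFin)

unique-↭-allFin : {xs : List (Fin n)} → Unique xs → n ≤ length xs → xs ↭ allFin n
unique-↭-allFin u n≤ = unique-⊇⇒↭ u (λ _ → ∈-allFin _) (≤-trans (≤-reflexive length-allFin) n≤)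

-- The order of appearance in a list.

data Before {A : Set} (x y : A) : List A → Set where
  here  : ∀ {xs} → y ∈ xs → Before x y (x ∷ xs)
  there : ∀ {z xs} → Before x y xs → Before x y (z ∷ xs)

before-or-after : {x y : A} {xs : List A} → x ∈ xs → y ∈ xs → x ≡ y ⊎ Before x y xs ⊎ Before y x xs
before-or-after (here refl) (here refl) = inj₁ refl
before-or-after (here refl) (there y∈)  = inj₂ (inj₁ (here y∈))
before-or-after (there x∈)  (here refl) = inj₂ (inj₂ (here x∈))
before-or-after (there x∈)  (there y∈) with before-or-after x∈ y∈
... | inj₁ eq       = inj₁ eq
... | inj₂ (inj₁ b) = inj₂ (inj₁ (there b))
... | inj₂ (inj₂ b) = inj₂ (inj₂ (there b))

before⇒∈ʳ : {x y : A} {xs : List A} → Before x y xs → y ∈ xs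
before⇒∈ʳ (here y∈) = there y∈
before⇒∈ʳ (there b) = there (before⇒∈ʳ b)

before⇒∈ˡ : {x y : A} {xs : List A} → Before x y xs → x ∈ xs
before⇒∈ˡ (here y∈) = here refl
before⇒∈ˡ (there b) = there (before⇒∈ˡ b)

before-trans : {x y z : A} {xs : List A} → Unique xs → Before x y xs → Before y z xs → Before x z xs
before-trans u (here _)  b′         = here (tail u b′)
  where
  tail : ∀ {x y z xs} → Unique (x ∷ xs) → Before y z (x ∷ xs) → z ∈ xs
  tail _ (here z∈) = z∈
  tail _ (there b) = before⇒∈ʳ b
before-trans u (there b) (here z∈)  = contradiction refl (∉∷⇒≢ u (before⇒∈ʳ b))
before-trans (_ ∷ u) (there b) (there b′) = there (before-trans u b b′)

before-irrefl : {x : A} {xs : List A} → Unique xs → ¬ Before x x xs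
before-irrefl u       (here x∈) = Unique[x∷xs]⇒x∉xs u x∈
before-irrefl (_ ∷ u) (there b) = before-irrefl u b

before-++⁻ : ∀ {x y : A} xs {ys} → Before x y (xs ++ ys) → Before x y xs ⊎ Before x y ys ⊎ (x ∈ xs × y ∈ ys)
before-++⁻ []       b = inj₂ (inj₁ b)
before-++⁻ (x ∷ xs) (here y∈) with ∈-++⁻ xs y∈
... | inj₁ y∈xs = inj₁ (here y∈xs)
... | inj₂ y∈ys = inj₂ (inj₂ (here refl , y∈ys))
before-++⁻ (x ∷ xs) (there b) with before-++⁻ xs b
... | inj₁ b′               = inj₁ (there b′)
... | inj₂ (inj₁ b′)        = inj₂ (inj₁ b′)
... | inj₂ (inj₂ (p , q)) = inj₂ (inj₂ (there p , q))

before-penultimate : ∀ {q s v : A} xs → Unique (xs ++ q ∷ v ∷ []) → Before q s (xs ++ q ∷ v ∷ []) → s ≡ v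
before-penultimate []       u (here (here eq))          = eq
before-penultimate []       u (there (here ()))
before-penultimate []       u (there (there ()))
before-penultimate (x ∷ xs) u (here _)                  = contradiction refl (∉∷⇒≢ u (∈-insert xs))
before-penultimate (x ∷ xs) (_ ∷ u) (there b)           = before-penultimate xs u b

-- Consecutive pairs, counting, and finite search.

linked-of-splits : {R : A → A → Set} (xs : List A) →
  (∀ as {t t′} bs → xs ≡ as ++ t ∷ t′ ∷ bs → R t t′) → Linked R xs
linked-of-splits []           _ = []
linked-of-splits (x ∷ [])     _ = [-]
linked-of-splits (x ∷ y ∷ xs) f =
  f [] xs refl ∷ linked-of-splits (y ∷ xs) (λ as bs eq → f (x ∷ as) bs (cong (x ∷_) eq))

filter-≤1 : {P : A → Set} (P? : Decidable P) {xs : List A} →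
  AllPairs (λ x y → ¬ (P x × P y)) xs → length (filter P? xs) ≤ 1
filter-≤1 P? []                 = z≤n
filter-≤1 P? {x ∷ xs} (p ∷ ps) with P? x
... | no _   = filter-≤1 P? ps
... | yes px = s≤s (≤-reflexive (none xs p))
  where
  none : ∀ ys → All (λ y → ¬ _) ys → length (filter P? ys) ≡ 0
  none []       []       = refl
  none (y ∷ ys) (q ∷ qs) with P? y
  ... | yes py = contradiction (px , py) q
  ... | no _   = none ys qs

filter-member : {P : A → Set} (P? : Decidable P) (xs : List A) → 1 ≤ length (filter P? xs) → ∃ λ x → x ∈ xs × P x
filter-member P? (x ∷ xs) p with P? x
... | yes px = x , here refl , px
... | no _   = let y , y∈ , py = filter-member P? xs p in y , there y∈ , py

anyList? : ∀ m {P : List (Fin n) → Set} → Decidable P → Dec (∃ λ xs → length xs ≡ m × P xs)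
anyList? zero P? = map′ (λ p → [] , refl , p) (λ { ([] , _ , p) → p }) (P? [])
anyList? (suc m) P? =
  map′ (λ (x , xs , eq , p) → x ∷ xs , cong suc eq , p)
       (λ { (x ∷ xs , eq , p) → x , xs , suc-injective eq , p })
       (any? (λ x → anyList? m (P? ∘ (x ∷_))))

-- Needed because attachment to a component is defined through the existence of walks. By induction
-- all elements but `zero` may be taken as decided; then `P zero` can be answered with `no`, since a
-- proof of it would complete a decision procedure.
¬¬-decidable : {P : Fin n → Set} → ¬ ¬ Decidable P
¬¬-decidable {zero}      k = k (λ ())
¬¬-decidable {suc n} {P} k = ¬¬-decidable {n} {P ∘ suc} λ d →
  k λ where
    zero    → no λ p → k λ where
      zero    → yes p
      (suc i) → d i
    (suc i) → d i


-- Rearrangements behind the reroutings of a path.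

module _ {A : Set} where
  open Solver (++-commutativeMonoid {A = A}) using (solve; _⊕_; _⊜_)

  ↭-detour : (p u q : List A) → p ++ u ++ q ↭ u ++ p ++ q
  ↭-detour = solve 3 (λ p u q → p ⊕ (u ⊕ q) ⊜ u ⊕ (p ⊕ q)) ↭-refl

  ↭-crossing : (p u q r s : List A) → p ++ u ++ reverse q ++ r ++ s ↭ (u ++ r) ++ p ++ q ++ s
  ↭-crossing p u q r s = ↭-trans (↭-++⁺ˡ p (↭-++⁺ˡ u (↭-++⁺ʳ (r ++ s) (↭-reverse q))))
    (solve 5 (λ p u q r s → p ⊕ (u ⊕ (q ⊕ (r ⊕ s))) ⊜ (u ⊕ r) ⊕ (p ⊕ (q ⊕ s))) ↭-refl p u q r s)

  ↭-swap-out : (α β γ : List A) (h v : A) → v ∷ α ++ h ∷ reverse β ++ γ ↭ h ∷ (α ++ β) ++ v ∷ γ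
  ↭-swap-out α β γ h v = ↭-trans (↭-++⁺ˡ (v ∷ α) (↭-++⁺ˡ [ h ] (↭-++⁺ʳ γ (↭-reverse β))))
    (solve 5 (λ a b c h v → v ⊕ (a ⊕ (h ⊕ (b ⊕ c))) ⊜ h ⊕ ((a ⊕ b) ⊕ (v ⊕ c))) ↭-refl α β γ [ h ] [ v ])

  ↭-swap-in : (α β γ : List A) (h v : A) → v ∷ α ++ h ∷ reverse β ++ γ ↭ h ∷ α ++ v ∷ β ++ γ
  ↭-swap-in α β γ h v = ↭-trans (↭-++⁺ˡ (v ∷ α) (↭-++⁺ˡ [ h ] (↭-++⁺ʳ γ (↭-reverse β))))
    (solve 5 (λ a b c h v → v ⊕ (a ⊕ (h ⊕ (b ⊕ c))) ⊜ h ⊕ (a ⊕ (v ⊕ (b ⊕ c)))) ↭-refl α β γ [ h ] [ v ])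

  ↭-late : (p q r s : List A) (h : A) → p ++ r ++ h ∷ reverse q ++ s ↭ h ∷ p ++ q ++ r ++ s
  ↭-late p q r s h = ↭-trans (↭-++⁺ˡ p (↭-++⁺ˡ r (↭-++⁺ˡ [ h ] (↭-++⁺ʳ s (↭-reverse q)))))
    (solve 5 (λ p q r s h → p ⊕ (r ⊕ (h ⊕ (q ⊕ s))) ⊜ h ⊕ (p ⊕ (q ⊕ (r ⊕ s)))) ↭-refl p q r s [ h ])

  ↭-early : (p q r s : List A) (h : A) → p ++ h ∷ reverse q ++ reverse r ++ s ↭ h ∷ (p ++ q ++ r) ++ s
  ↭-early p q r s h = ↭-trans (↭-++⁺ˡ p (↭-++⁺ˡ [ h ] (↭-++⁺ (↭-reverse q) (↭-++⁺ʳ s (↭-reverse r)))))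
    (solve 5 (λ p q r s h → p ⊕ (h ⊕ (q ⊕ (r ⊕ s))) ⊜ h ⊕ ((p ⊕ (q ⊕ r)) ⊕ s)) ↭-refl p q r s [ h ])

  ↭-across : (p q r s : List A) (h : A) → p ++ h ∷ reverse r ++ q ++ s ↭ h ∷ (p ++ q) ++ r ++ s
  ↭-across p q r s h = ↭-trans (↭-++⁺ˡ p (↭-++⁺ˡ [ h ] (↭-++⁺ʳ (q ++ s) (↭-reverse r))))
    (solve 5 (λ p q r s h → p ⊕ (h ⊕ (r ⊕ (q ⊕ s))) ⊜ h ⊕ ((p ⊕ q) ⊕ (r ⊕ s))) ↭-refl p q r s [ h ])

  ↭-rotate : (p q r : List A) → p ++ q ++ r ↭ r ++ p ++ q
  ↭-rotate = solve 3 (λ p q r → p ⊕ (q ⊕ r) ⊜ r ⊕ (p ⊕ q)) ↭-refl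

-- Vertex sets as lists, and the two hypotheses on the graph.

module Graphs {n : ℕ} (G : Graph n) where

  V : Set
  V = Fin n

  infix 4 _~_ _~?_
  _~_ : V → V → Set
  u ~ v = adj G u v ≡ true

  _~?_ : ∀ u v → Dec (u ~ v)
  u ~? v = adj G u v Bool.≟ true

  ~-sym : ∀ {u v} → u ~ v → v ~ u
  ~-sym {u} {v} e = trans (Graph.sym G v u) e

  ~-irrefl : ∀ {v} → ¬ v ~ v
  ~-irrefl {v} e with trans (≡-sym e) (Graph.irrefl G v)
  ... | ()

  _∈?_ : (v : V) (l : List V) → Dec (v ∈ l)
  _∈?_ = member? _≟_

  Independent : List V → Set
  Independent l = ∀ {u v} → u ∈ l → v ∈ l → ¬ u ~ v

  ⟦_⟧ : List V → Subset n
  ⟦ [] ⟧    = ⊥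
  ⟦ v ∷ l ⟧ = ⟦ l ⟧ [ v ]≔ inside

  ∈⇒inside : ∀ {l v} → v ∈ l → lookup ⟦ l ⟧ v ≡ true
  ∈⇒inside {u ∷ l} {v} v∈ with v ≟ u | v∈
  ... | yes refl | _          = lookup∘update v ⟦ l ⟧ true
  ... | no v≢u   | here eq    = contradiction eq v≢u
  ... | no v≢u   | there v∈l = trans (lookup∘update′ v≢u ⟦ l ⟧ true) (∈⇒inside v∈l)

  inside⇒∈ : ∀ l {v} → lookup ⟦ l ⟧ v ≡ true → v ∈ l
  inside⇒∈ [] {v} e with trans (≡-sym e) (lookup-replicate v false)
  ... | ()
  inside⇒∈ (u ∷ l) {v} e with v ≟ u
  ... | yes refl = here refl
  ... | no v≢u   = there (inside⇒∈ l (trans (≡-sym (lookup∘update′ v≢u ⟦ l ⟧ true)) e))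

  card-insert≤ : ∀ {m} (S : Subset m) v → ∣ S [ v ]≔ inside ∣ ≤ suc ∣ S ∣
  card-insert≤ (true ∷ S)  zero    = m≤n⇒m≤1+n ≤-refl
  card-insert≤ (false ∷ S) zero    = ≤-refl
  card-insert≤ (true ∷ S)  (suc v) = s≤s (card-insert≤ S v)
  card-insert≤ (false ∷ S) (suc v) = card-insert≤ S v

  card-insert : ∀ {m} (S : Subset m) v → ¬ lookup S v ≡ true → ∣ S [ v ]≔ inside ∣ ≡ suc ∣ S ∣
  card-insert (true ∷ S)  zero    v∉ = contradiction refl v∉
  card-insert (false ∷ S) zero    v∉ = refl
  card-insert (true ∷ S)  (suc v) v∉ = cong suc (card-insert S v v∉)
  card-insert (false ∷ S) (suc v) v∉ = card-insert S v v∉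

  card≤ : ∀ l → ∣ ⟦ l ⟧ ∣ ≤ length l
  card≤ []      = ≤-reflexive (∣⊥∣≡0 n)
  card≤ (v ∷ l) = ≤-trans (card-insert≤ ⟦ l ⟧ v) (s≤s (card≤ l))

  card≡ : ∀ {l} → Unique l → ∣ ⟦ l ⟧ ∣ ≡ length l
  card≡ {[]}    _         = ∣⊥∣≡0 n
  card≡ {v ∷ l} u@(_ ∷ u′) =
    trans (card-insert ⟦ l ⟧ v (Unique[x∷xs]⇒x∉xs u ∘ inside⇒∈ l)) (cong suc (card≡ u′))

  -- Ordered by `toℕ`, so that every edge is a single pair and distinct pairs are distinct edges.
  Edge : List V → V × V → Set
  Edge l (u , v) = toℕ u < toℕ v × u ∈ l × v ∈ l × u ~ v

  two-edges : ∀ {k} → STGraph G (suc k) 2 → ∀ {l} → Unique l → length l ≡ suc k →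
    ∃₂ λ e f → Edge l e × Edge l f × e ≢ f
  two-edges st {l} u len =
    let e , f , e∈ , f∈ , e≢f = two-members
          (Unique-filter (Bool.T? ∘ isEdge) (cartesianProduct⁺ (allFin⁺ n) (allFin⁺ n)))
          (st ⟦ l ⟧ (trans (card≡ u) len))
    in e , f , edge e∈ , edge f∈ , e≢f
    where
    open Equivalence
    isEdge : V × V → Bool
    isEdge p = (toℕ (proj₁ p) <ᵇ toℕ (proj₂ p)) ∧
      (lookup ⟦ l ⟧ (proj₁ p) ∧ (lookup ⟦ l ⟧ (proj₂ p) ∧ adj G (proj₁ p) (proj₂ p)))

    pairs : List (V × V)
    pairs = cartesianProduct (allFin n) (allFin n)

    edge : ∀ {e} → e ∈ filter (Bool.T? ∘ isEdge) pairs → Edge l e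
    edge {a , b} e∈ =
      let lt , r   = to Bool.T-∧ (proj₂ (∈-filter⁻ (Bool.T? ∘ isEdge) {xs = pairs} e∈))
          a∈ , r′  = to Bool.T-∧ r
          b∈ , a~b = to Bool.T-∧ r′
      in <ᵇ⇒< (toℕ a) (toℕ b) lt , inside⇒∈ l (to Bool.T-≡ a∈) , inside⇒∈ l (to Bool.T-≡ b∈) , to Bool.T-≡ a~b

  module _ {k} (st : STGraph G (suc k) 2) where

    -- Otherwise its first `k + 1` members would span an edge.
    independent-length≤ : ∀ {l} → Unique l → Independent l → length l ≤ k
    independent-length≤ {l} u ind = ≮⇒≥ λ k<l →
      let (a , b) , _ , (_ , a∈ , b∈ , a~b) , _ =
            two-edges st (Unique-take (suc k) u) (trans (length-take (suc k) l) (m≤n⇒m⊓n≡m k<l))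
      in ind (take⊆ a∈) (take⊆ b∈) a~b
      where
      take⊆ : ∀ {v} → v ∈ List.take (suc k) l → v ∈ l
      take⊆ v∈ = subst (_ ∈_) (take++drop≡id (suc k) l) (∈-++⁺ˡ v∈)

    -- The `k + 1` vertices of `t ∷ l` span two edges, and independence of `l` forces `t` into both.
    two-neighbours : ∀ {l t} → Unique l → Independent l → length l ≡ k → t ∉ l →
      ∃₂ λ s s′ → s ∈ l × s′ ∈ l × s ≢ s′ × s ~ t × s′ ~ t
    two-neighbours {l} {t} u ind len t∉ with two-edges st (¬Any⇒All¬ l t∉ ∷ u) (cong suc len)
    ... | e , f , E , F , e≢f with end E | end F
      where
      end : ∀ {e} → Edge (t ∷ l) e → ∃ λ s → s ∈ l × s ~ t × (toℕ s < toℕ t × e ≡ (s , t) ⊎ toℕ t < toℕ s × e ≡ (t , s))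
      end (lt , here refl , here refl , a~b) = contradiction a~b ~-irrefl
      end (lt , here refl , there b∈ , a~b)  = _ , b∈ , ~-sym a~b , inj₂ (lt , refl)
      end (lt , there a∈ , here refl , a~b)  = _ , a∈ , a~b , inj₁ (lt , refl)
      end (lt , there a∈ , there b∈ , a~b)   = contradiction a~b (ind a∈ b∈)
    ... | s , s∈ , s~t , c | s′ , s′∈ , s′~t , c′ =
      s , s′ , s∈ , s′∈ , (λ eq → e≢f (same eq c c′)) , s~t , s′~t
      where
      -- With equal ends the pairs agree, because the order of `s` and `t` decides which of them
      -- comes first.
      same : s ≡ s′ → toℕ s < toℕ t × e ≡ (s , t) ⊎ toℕ t < toℕ s × e ≡ (t , s) →
        toℕ s′ < toℕ t × f ≡ (s′ , t) ⊎ toℕ t < toℕ s′ × f ≡ (t , s′) → e ≡ f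
      same refl (inj₁ (_ , refl)) (inj₁ (_ , refl)) = refl
      same refl (inj₂ (_ , refl)) (inj₂ (_ , refl)) = refl
      same refl (inj₁ (p , _))    (inj₂ (q , _))    = contradiction q (<-asym p)
      same refl (inj₂ (p , _))    (inj₁ (q , _))    = contradiction p (<-asym q)

  -- A walk that starts in `C` and avoids `A` never leaves `C`, so `A` separates `u` from `z`, which
  -- fewer than `k` vertices cannot do.
  boundary-length : ∀ {k} → KConnected G k → (C : V → Set) (A : List V) →
    (∀ {u w} → C u → u ~ w → C w ⊎ w ∈ A) →
    ∀ {u z} → C u → u ∉ A → ¬ C z → z ∉ A → k ≤ length A
  boundary-length (_ , conn) C A closed {u} {z} Cu u∉A ¬Cz z∉A = ≮⇒≥ λ lt →
    let _ , w , avoids = conn ⟦ A ⟧ (≤-<-trans (card≤ A) lt) u z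
          (u∉A ∘ inside⇒∈ A ∘ []=⇒lookup) (z∉A ∘ inside⇒∈ A ∘ []=⇒lookup)
    in stays w (All.map (λ ∉S ∈A → ∉S (lookup⇒[]= _ ⟦ A ⟧ (∈⇒inside ∈A))) avoids) Cu ¬Cz
    where
    start∉ : ∀ {a b ws} → Walk G a b ws → All (_∉ A) ws → a ∉ A
    start∉ (here _)   (p ∷ _) = p
    start∉ (step _ _) (p ∷ _) = p
    stays : ∀ {a b ws} → Walk G a b ws → All (_∉ A) ws → C a → ¬ C b → False
    stays (here _)   _        Ca ¬Cb = ¬Cb Ca
    stays (step e w) (_ ∷ ps) Ca ¬Cb with closed Ca e
    ... | inj₁ Cy = stays w ps Cy ¬Cb
    ... | inj₂ y∈ = start∉ w ps y∈

  -- Walks and paths.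

  start∈ : ∀ {a b ws} → Walk G a b ws → a ∈ ws
  start∈ (here _)   = here refl
  start∈ (step _ _) = here refl

  walk-∷ : ∀ {a b ws} → Walk G a b ws → ∃ λ us → ws ≡ a ∷ us
  walk-∷ (here _)   = _ , refl
  walk-∷ (step _ _) = _ , refl

  end∈ : ∀ {a b ws} → Walk G a b ws → b ∈ ws
  end∈ (here _)   = here refl
  end∈ (step _ w) = there (end∈ w)

  join : ∀ {a b c d us vs} → Walk G a b us → b ~ c → Walk G c d vs → Walk G a d (us ++ vs)
  join (here _)   e w′ = step e w′
  join (step f w) e w′ = step f (join w e w′)

  walk-trans : ∀ {a b c us vs} → Walk G a b us → Walk G b c vs →
    ∃ λ ws → Walk G a c ws × (∀ {v} → v ∈ ws → v ∈ us ⊎ v ∈ vs)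
  walk-trans (here _)       w′ = _ , w′ , inj₂
  walk-trans (step {x} e w) w′ =
    let ws , w″ , f = walk-trans w w′
    in x ∷ ws , step e w″ , λ { (here eq) → inj₁ (here eq) ; (there v∈) → map₁ there (f v∈) }

  walk-reverse : ∀ {a b ws} → Walk G a b ws → Walk G b a (reverse ws)
  walk-reverse (here _) = here _
  walk-reverse {ws = x ∷ ws} (step e w) =
    subst (Walk G _ _) (≡-sym (unfold-reverse x ws)) (join (walk-reverse w) (~-sym e) (here x))

  walk-split : ∀ {a b t r} l → Walk G a b (l ++ t ∷ r) → Walk G a t (l ++ [ t ]) × Walk G t b (t ∷ r)
  walk-split []      (here _)   = here _ , here _
  walk-split []      (step e w) = here _ , step e w
  walk-split (x ∷ []) (step e w) with walk-split [] w
  ... | w₁ , w₂ = step e w₁ , w₂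
  walk-split (x ∷ l@(_ ∷ _)) (step e w) with walk-split l w
  ... | w₁ , w₂ = step e w₁ , w₂

  -- Loop erasure.
  walk⇒path : ∀ {a b ws} → Walk G a b ws → ∃ λ us → Walk G a b us × Unique us × (∀ {v} → v ∈ us → v ∈ ws)
  walk⇒path (here x) = [ x ] , here x , [] ∷ [] , id
  walk⇒path (step {x} e w) with walk⇒path w
  ... | us , p , u , us⊆ with x ∈? us
  ...   | no x∉  = x ∷ us , step e p , ¬Any⇒All¬ us x∉ ∷ u , λ { (here eq) → here eq ; (there v∈) → there (us⊆ v∈) }
  ...   | yes x∈ with ∈-∃++ x∈
  ...     | l , r , refl =
    x ∷ r , proj₂ (walk-split l p) , unique-++⁻ʳ l u , λ v∈ → there (us⊆ (∈-++⁺ʳ l v∈))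

  walk? : ∀ a b ws → Dec (Walk G a b ws)
  walk? a b []           = no λ ()
  walk? a b (x ∷ [])     = map′ (λ { (refl , refl) → here _ }) (λ { (here _) → refl , refl ; (step _ ()) }) (a ≟ x ×-dec b ≟ x)
  walk? a b (x ∷ y ∷ ws) =
    map′ (λ { (refl , e , w) → step e w })
         (λ { (step e w@(here _)) → refl , e , w ; (step e w@(step _ _)) → refl , e , w })
         (a ≟ x ×-dec (x ~? y) ×-dec walk? y b (y ∷ ws))

  -- Such a path lists each of the `n` vertices once, so searching the lists of length `n` suffices.
  hamiltonianPath? : ∀ x y → Dec (HamiltonianPath G x y)
  hamiltonianPath? x y =
    map′ (λ (ws , _ , p) → ws , p)
         (λ (ws , w , u , c) → ws , ≤-antisym (unique-length≤ u)
            (≤-trans (≤-reflexive (≡-sym length-allFin)) (unique-⊆-length (allFin⁺ n) (λ _ → c _))) , w , u , c)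
         (anyList? n (λ ws → walk? x y ws ×-dec (unique? _≟_ ws ×-dec all? (_∈? ws))))

  -- Inserting a vertex between two consecutive neighbours.

  data Slot (s : V) : List V → Set where
    here  : ∀ {t t′ ws} → s ~ t → s ~ t′ → Slot s (t ∷ t′ ∷ ws)
    there : ∀ {t ws} → Slot s ws → Slot s (t ∷ ws)

  slot-++⁺ˡ : ∀ {s us} ws → Slot s us → Slot s (us ++ ws)
  slot-++⁺ˡ ws (here e e′) = here e e′
  slot-++⁺ˡ ws (there p)   = there (slot-++⁺ˡ ws p)

  slot-++⁺ʳ : ∀ {s ws} us → Slot s ws → Slot s (us ++ ws)
  slot-++⁺ʳ []       p = p
  slot-++⁺ʳ (_ ∷ us) p = there (slot-++⁺ʳ us p)

  -- A slot for `s` cannot use the non-neighbour `r`, so it lies wholly on one side of it.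
  slot-++⁻ : ∀ {s r ws} us → ¬ s ~ r → Slot s (us ++ r ∷ ws) → Slot s us ⊎ Slot s ws
  slot-++⁻ []           ¬e (here e _)  = contradiction e ¬e
  slot-++⁻ []           ¬e (there p)   = inj₂ p
  slot-++⁻ (u ∷ [])     ¬e (here _ e)  = contradiction e ¬e
  slot-++⁻ (u ∷ _ ∷ us) ¬e (here e e′) = inj₁ (here e e′)
  slot-++⁻ (u ∷ us@[])  ¬e (there p)   = map₁ there (slot-++⁻ us ¬e p)
  slot-++⁻ (u ∷ us@(_ ∷ _)) ¬e (there p) = map₁ there (slot-++⁻ us ¬e p)

  slot-reverse : ∀ {s ws} → Slot s ws → Slot s (reverse ws)
  slot-reverse {ws = t ∷ ws} (there p) =
    subst (Slot _) (≡-sym (unfold-reverse t ws)) (slot-++⁺ˡ [ t ] (slot-reverse p))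
  slot-reverse {s} {t ∷ t′ ∷ ws} (here e e′) = subst (Slot s)
    (≡-sym (trans (reverse-++ (t ∷ t′ ∷ []) ws) refl)) (slot-++⁺ʳ (reverse ws) (here e′ e))

  slot-insert : ∀ {s a b ws} → Walk G a b ws → Slot s ws → ∃ λ us → Walk G a b us × us ↭ s ∷ ws
  slot-insert {s} (step {x = t} e w) (here s~t s~t′) with w
  ... | here t′ = _ , step (~-sym s~t) (step s~t′ (here t′)) , ↭-swap t s ↭-refl
  ... | step e′ w′ = _ , step (~-sym s~t) (step s~t′ (step e′ w′)) , ↭-swap t s ↭-refl
  slot-insert {s} (step {x = t} e w) (there p) =
    let us , w′ , perm = slot-insert w p
    in t ∷ us , step e w′ , ↭-trans (prep t perm) (↭-swap t s ↭-refl)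
  slot-insert (here _) (there ())

-- Lists cut into blocks, and counting block by block.

module _ {A : Set} where

  flat : List (A × List A) → List A
  flat []             = []
  flat ((v , B) ∷ ss) = v ∷ B ++ flat ss

  heads : List (A × List A) → List A
  heads = map proj₁

  flat-++ : ∀ ls {rs} → flat (ls ++ rs) ≡ flat ls ++ flat rs
  flat-++ []             = refl
  flat-++ ((v , B) ∷ ls) = cong (v ∷_) (trans (cong (B ++_) (flat-++ ls)) (≡-sym (++-assoc B (flat ls) _)))

  heads⊆flat : ∀ ss {d} → d ∈ heads ss → d ∈ flat ss
  heads⊆flat ((v , B) ∷ ss) (here eq)  = here eq
  heads⊆flat ((v , B) ∷ ss) (there d∈) = there (∈-++⁺ʳ B (heads⊆flat ss d∈))

  unique-heads : ∀ ss → Unique (flat ss) → Unique (heads ss)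
  unique-heads []             _          = []
  unique-heads ((v , B) ∷ ss) u@(_ ∷ u′) =
    ¬Any⇒All¬ _ (Unique[x∷xs]⇒x∉xs u ∘ ∈-++⁺ʳ B ∘ heads⊆flat ss) ∷ unique-heads ss (unique-++⁻ʳ B u′)

  body∉heads : ∀ ls {v B rs t} → Unique (flat (ls ++ (v , B) ∷ rs)) → t ∈ B → t ∉ heads (ls ++ (v , B) ∷ rs)
  body∉heads [] {B = B} u t∈ (here refl) = Unique[x∷xs]⇒x∉xs u (∈-++⁺ˡ t∈)
  body∉heads [] {B = B} {rs} (_ ∷ u) t∈ (there d∈) = unique-++-disjoint B u t∈ (heads⊆flat rs d∈)
  body∉heads ((v′ , B′) ∷ ls) u t∈ (here refl) =
    Unique[x∷xs]⇒x∉xs u (∈-++⁺ʳ B′ (body⊆flat ls t∈))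
    where
    body⊆flat : ∀ ls {v B rs t} → t ∈ B → t ∈ flat (ls ++ (v , B) ∷ rs)
    body⊆flat []             t∈ = there (∈-++⁺ˡ t∈)
    body⊆flat ((_ , B) ∷ ls) t∈ = there (∈-++⁺ʳ B (body⊆flat ls t∈))
  body∉heads ((v′ , B′) ∷ ls) (_ ∷ u) t∈ (there d∈) = body∉heads ls (unique-++⁻ʳ B′ u) t∈ d∈

  module _ {P : A → Set} (P? : Decidable P) where

    private
      count : List A → ℕ
      count = length ∘ filter P?

      count-++ : ∀ xs ys → count (xs ++ ys) ≡ count xs + count ys
      count-++ xs ys = trans (cong length (filter-++ P? xs ys)) (length-++ (filter P? xs))

    count-flat≤ : ∀ {ss} → (∀ {v B} → (v , B) ∈ ss → count (v ∷ B) ≤ 1) → count (flat ss) ≤ length ss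
    count-flat≤ {[]}           _ = z≤n
    count-flat≤ {(v , B) ∷ ss} f = ≤-trans (≤-reflexive (count-++ (v ∷ B) (flat ss)))
      (+-mono-≤ (f (here refl)) (count-flat≤ (f ∘ there)))

    -- With at most one hit per block and at least as many hits as blocks, no block can be missed.
    count-flat-tight : ∀ {ss} → (∀ {v B} → (v , B) ∈ ss → count (v ∷ B) ≤ 1) → length ss ≤ count (flat ss) →
      ∀ {v B} → (v , B) ∈ ss → 1 ≤ count (v ∷ B)
    count-flat-tight {(v , B) ∷ ss} f le (here refl) =
      +-cancelʳ-≤ (length ss) 1 _ (≤-trans le (≤-trans (≤-reflexive (count-++ (v ∷ B) (flat ss)))
        (+-monoʳ-≤ _ (count-flat≤ (f ∘ there)))))
    count-flat-tight {(v , B) ∷ ss} f le (there m) =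
      count-flat-tight (f ∘ there)
        (s≤s⁻¹ (≤-trans le (≤-trans (≤-reflexive (count-++ (v ∷ B) (flat ss))) (+-monoˡ-≤ _ (f (here refl)))))) m

-- Cutting a path after its attached vertices.

module Chains {n : ℕ} (G : Graph n) (Att : Fin n → Set) where

  open Graphs G

  data Stretch : V → V → List V → Set where
    end : ∀ {e} → Stretch e e [ e ]
    on  : ∀ {u v e ws} → ¬ Att u → u ~ v → Stretch v e ws → Stretch u e (u ∷ ws)

  -- The start `a` is the last vertex of the preceding piece and is not listed in the blocks.
  -- Nothing is asked of the end `c`, so a path broken off inside a block still gives a chain.
  data Chain : V → V → List (V × List V) → Set where
    []  : ∀ {a} → Chain a a []
    seg : ∀ {a v b c B ss} → Att a → a ~ v → Stretch v b (v ∷ B) → Chain b c ss → Chain a c ((v , B) ∷ ss)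

  stretch-walk : ∀ {u e ws} → Stretch u e ws → Walk G u e ws
  stretch-walk end        = here _
  stretch-walk (on _ e s) = step e (stretch-walk s)

  stretch-∷ : ∀ {u e ws} → Stretch u e ws → ∃ λ B → ws ≡ u ∷ B
  stretch-∷ end        = _ , refl
  stretch-∷ (on _ _ _) = _ , refl

  stretch-tail : ∀ {u e u′ w ws} → Stretch u e (u′ ∷ w ∷ ws) → u ~ w × Stretch w e (w ∷ ws)
  stretch-tail (on _ e s@end)        = e , s
  stretch-tail (on _ e s@(on _ _ _)) = e , s

  stretch-att : ∀ {u e ws} → Stretch u e ws → Att u → u ≡ e × ws ≡ [ e ]
  stretch-att end        _  = refl , refl
  stretch-att (on ¬a _ _) a = contradiction a ¬a

  stretch-split : ∀ {u e t t′ r} l → Stretch u e (l ++ t ∷ t′ ∷ r) →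
    Stretch u t (l ++ [ t ]) × t ~ t′ × Stretch t′ e (t′ ∷ r)
  stretch-split []           (on ¬a e s@end)          = end , e , s
  stretch-split []           (on ¬a e s@(on _ _ _))   = end , e , s
  stretch-split (x ∷ [])     (on ¬a e s)              =
    let s₁ , e′ , s₂ = stretch-split [] s in on ¬a e s₁ , e′ , s₂
  stretch-split (x ∷ l@(_ ∷ _)) (on ¬a e s)           =
    let s₁ , e′ , s₂ = stretch-split l s in on ¬a e s₁ , e′ , s₂

  stretch-not-att : ∀ {u e t t′ r} l → Stretch u e (l ++ t ∷ t′ ∷ r) → ¬ Att t
  stretch-not-att []              (on ¬a _ _) = ¬a
  stretch-not-att (_ ∷ [])        (on _ _ s)  = stretch-not-att [] s
  stretch-not-att (_ ∷ l@(_ ∷ _)) (on _ _ s)  = stretch-not-att l s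

  extend : ∀ {u a b ws ss} → Walk G u a ws → Chain a b ss → Walk G u b (ws ++ flat ss)
  extend {ws = ws} w []           = subst (Walk G _ _) (≡-sym (++-identityʳ ws)) w
  extend {ws = ws} w (seg {B = B} {ss} _ e s c) =
    subst (Walk G _ _) (++-assoc ws _ (flat ss)) (extend (join w e (stretch-walk s)) c)

  chain-++⁻ : ∀ {a c} ls {rs} → Chain a c (ls ++ rs) → ∃ λ b → Chain a b ls × Chain b c rs
  chain-++⁻ []       c             = _ , [] , c
  chain-++⁻ (_ ∷ ls) (seg a e s c) = let b , c₁ , c₂ = chain-++⁻ ls c in b , seg a e s c₁ , c₂

  chain-++⁺ : ∀ {a b c ls rs} → Chain a b ls → Chain b c rs → Chain a c (ls ++ rs)
  chain-++⁺ []             c′ = c′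
  chain-++⁺ (seg a e s c) c′ = seg a e s (chain-++⁺ c c′)

  chain-end : ∀ {a b ss} → Chain a b ss → Att b → Att a
  chain-end []            att = att
  chain-end (seg a _ _ _) _   = a

  -- The piece before a head `d` ends in an attached vertex, where a rerouted path can leave towards
  -- the outside vertices.
  record Cut (u d b : V) (ws : List V) : Set where
    constructor cut-at
    field
      {p q} : List V
      {c}   : V
      eq    : ws ≡ p ++ q
      left  : Walk G u c p
      att   : Att c
      right : Walk G d b q
      edge  : c ~ d

  record Cut₂ (u d d′ b : V) (ws : List V) : Set where
    constructor cut-at₂
    field
      {p q r} : List V
      {c c′}  : V
      eq      : ws ≡ p ++ q ++ r
      left    : Walk G u c p
      att     : Att c
      mid     : Walk G d c′ q
      att′    : Att c′
      right   : Walk G d′ b r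

  cut : ∀ {u a b d ws ss} → Walk G u a ws → Chain a b ss → d ∈ heads ss → Cut u d b (ws ++ flat ss)
  cut w (seg a e s c) (here refl) = cut-at refl w a (extend (stretch-walk s) c) e
  cut {ws = ws} w (seg {v = v} {B = B} {ss} _ e s c) (there d∈) =
    subst (Cut _ _ _) (++-assoc ws (v ∷ B) (flat ss)) (cut (join w e (stretch-walk s)) c d∈)

  cut₂ : ∀ {u a b d d′ ws ss} → Walk G u a ws → Chain a b ss → Before d d′ (heads ss) → Cut₂ u d d′ b (ws ++ flat ss)
  cut₂ {ws = ws} w (seg a e s c) (here d∈) =
    let cut-at eq l a′ r _ = cut (stretch-walk s) c d∈ in cut-at₂ (cong (ws ++_) eq) w a l a′ r
  cut₂ {ws = ws} w (seg {v = v} {B = B} {ss} _ e s c) (there d∈) =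
    subst (Cut₂ _ _ _ _) (++-assoc ws (v ∷ B) (flat ss)) (cut₂ (join w e (stretch-walk s)) c d∈)

  module _ (att? : Decidable Att) where

    -- The initial stretch runs to the first attached vertex, or to the end of the walk if there is
    -- none.
    parse : ∀ {a y vs} → Walk G a y vs →
      ∃ λ c → ∃₂ λ ws ss → vs ≡ ws ++ flat ss × Stretch a c ws × Chain c y ss
    parse (here _)       = _ , _ , [] , refl , end , []
    parse (step {x} e w) with parse w | att? x
    ... | c , ws , ss , eq , s , ch | no ¬a = c , x ∷ ws , ss , cong (x ∷_) eq , on ¬a e s , ch
    ... | c , ws , ss , eq , s , ch | yes a with stretch-∷ s
    ...   | B , refl = x , [ x ] , (_ , B) ∷ ss , cong (x ∷_) eq , end , seg a e s ch

    stretch-count : ∀ {a e ws} → Stretch a e ws → length (filter att? ws) ≤ 1 × (¬ Att e → length (filter att? ws) ≤ 0)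
    stretch-count (end {e}) with att? e
    ... | yes a = ≤-refl , λ ¬a → contradiction a ¬a
    ... | no _  = z≤n , λ _ → z≤n
    stretch-count (on {u} ¬a _ s) with att? u
    ... | yes a = contradiction a ¬a
    ... | no _  = stretch-count s

    -- Only the last vertex of a stretch can be attached, so each of the `suc (length ss)` pieces
    -- contributes at most one, and the final piece none if `y` is unattached.
    count≤ : ∀ {a c y ws ss} → Stretch a c ws → Chain c y ss →
      length (filter att? (ws ++ flat ss)) ≤ suc (length ss) ×
      (¬ Att y → length (filter att? (ws ++ flat ss)) ≤ length ss)
    count≤ {ws = ws} s [] rewrite ++-identityʳ ws = stretch-count s
    count≤ {ws = ws} s (seg {v = v} {B = B} {ss} a e s′ c)
      rewrite filter-++ att? ws (v ∷ B ++ flat ss)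
            | length-++ (filter att? ws) {filter att? (v ∷ B ++ flat ss)} =
      +-mono-≤ (proj₁ (stretch-count s)) (proj₁ (count≤ s′ c)) ,
      λ ¬a → +-mono-≤ (proj₁ (stretch-count s)) (proj₂ (count≤ s′ c) ¬a)

-- A longest path and a component off it.

module Component {n k : ℕ} (G : Graph n) (kc : KConnected G k) (st : STGraph G (suc k) 2)
  {C Att : Fin n → Set} (att? : Decidable Att)
  (C⇒att : ∀ {w a} → C w → adj G w a ≡ true → Att a)
  (att⇒C : ∀ {a} → Att a → ∃ λ w → C w × adj G w a ≡ true)
  (connect : ∀ {u w} → C u → C w → ∃ λ us → Walk G u w us × Unique us × (∀ {v} → v ∈ us → C v))
  {h : Fin n} (Ch : C h)
  where

  open Graphs G
  open Chains G Att

  -- `C` is abstract because the notion is used twice: for the component of a vertex off a longest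
  -- path, and for `h` alone once a path misses nothing but `h`.
  record MaximalPath (x y : V) (vs : List V) : Set where
    field
      walk   : Walk G x y vs
      uniq   : Unique vs
      x≢y    : x ≢ y
      out    : ∀ {w} → C w → w ∉ vs
      closed : ∀ {u w} → C u → u ~ w → C w ⊎ w ∈ vs
      max    : ∀ {ws} → Walk G x y ws → Unique ws → length ws ≤ length vs

  maximalPath-reverse : ∀ {x y vs} → MaximalPath x y vs → MaximalPath y x (reverse vs)
  maximalPath-reverse {vs = vs} m = record
    { walk   = walk-reverse walk
    ; uniq   = Unique-resp-↭ (↭-sym (↭-reverse vs)) uniq
    ; x≢y    = x≢y ∘ ≡-sym
    ; out    = λ c w∈ → out c (∈-resp-↭ (↭-reverse vs) w∈)
    ; closed = λ c e → map₂ (∈-resp-↭ (↭-sym (↭-reverse vs))) (closed c e)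
    ; max    = λ {ws} w u → ≤-trans (≤-reflexive (≡-sym (length-reverse ws)))
                 (≤-trans (max (walk-reverse w) (Unique-resp-↭ (↭-sym (↭-reverse ws)) u))
                   (≤-reflexive (≡-sym (length-reverse vs))))
    }
    where open MaximalPath m

  module Maximal {x y vs} (m : MaximalPath x y vs) where
    open MaximalPath m

    no-extension : ∀ {E ws} → Walk G x y ws → ws ↭ E ++ vs → Unique E → (∀ {v} → v ∈ E → v ∉ vs) → ¬ 0 < length E
    no-extension {E} {ws} w p u disjoint pos = <-irrefl refl (≤-trans
      (≤-trans (+-monoˡ-≤ (length vs) pos) (≤-reflexive (trans (≡-sym (length-++ E)) (≡-sym (↭-length p)))))
      (max w (Unique-resp-↭ (↭-sym p) (Unique-++⁺ u uniq (λ (v∈E , v∈vs) → disjoint v∈E v∈vs)))))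

    record Detour (a c : V) : Set where
      field
        us     : List V
        walks  : ∀ {u b p q} → Walk G u a p → Walk G c b q → Walk G u b (p ++ us ++ q)
        unique : Unique us
        within : ∀ {v} → v ∈ us → C v
        pos    : 0 < length us

    detour : ∀ {a c} → Att a → Att c → Detour a c
    detour a c with att⇒C a | att⇒C c
    ... | w , Cw , w~a | w′ , Cw′ , w′~c with connect Cw Cw′
    ...   | us , wk , u , ⊆C = record
      { us = us
      ; walks = λ w₁ w₂ → join w₁ (~-sym w~a) (join wk w′~c w₂)
      ; unique = u ; within = ⊆C ; pos = nonempty wk }
      where
      nonempty : ∀ {a b ws} → Walk G a b ws → 0 < length ws
      nonempty (here _)   = s≤s z≤n
      nonempty (step _ _) = s≤s z≤n

    -- If `d` were attached, a detour through `C` between the attached vertex before `d` and `d`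
    -- itself would lengthen the path.
    head-not-att : ∀ {d} → Cut x d y vs → ¬ Att d
    head-not-att (cut-at {p} {q} eq l a r _) att-d =
      no-extension (walks l r)
        (↭-trans (↭-detour p us q) (↭-reflexive (cong (us ++_) (≡-sym eq))))
        unique (out ∘ within) pos
      where open Detour (detour a att-d)

    -- Follow the path to the vertex before `d`, cross `C` to the vertex before `d′`, go back to
    -- `d`, then through `R` to `d′` and on to `y`: no vertex is lost and the detour is gained. `R`
    -- is empty for an edge between heads and a single vertex for a common neighbour off the path.
    no-crossing : ∀ {d d′} → Cut₂ x d d′ y vs → ∀ R {z} → d ~ z → (∀ {q} → Walk G d′ y q → Walk G z y (R ++ q)) →
      Unique R → ¬ (∀ {v} → v ∈ R → v ∉ vs × ¬ C v)
    no-crossing (cut-at₂ {p} {q} {r} eq l a m a′ r′) R d~z tail uR R-out =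
      no-extension (walks l (join (walk-reverse m) d~z (tail r′)))
        (↭-trans (↭-crossing p us q R r) (↭-reflexive (cong ((us ++ R) ++_) (≡-sym eq))))
        (Unique-++⁺ unique uR (λ (v∈us , v∈R) → proj₂ (R-out v∈R) (within v∈us)))
        (λ v∈ → [ out ∘ within , proj₁ ∘ R-out ]′ (∈-++⁻ us v∈))
        (≤-trans pos (≤-trans (m≤m+n _ _) (≤-reflexive (≡-sym (length-++ us)))))
      where open Detour (detour a a′)

    -- This supplies the vertex that is cut off from `C`: if `x` is attached, then its successor is
    -- a head.
    not-all-att : ∃ λ z → z ∈ vs × ¬ Att z
    not-all-att with walk | refl {x = vs}
    ... | here _   | _ = contradiction refl x≢y
    ... | step {x} {z} e w | eq with att? x
    ...   | no ¬a = x , here refl , ¬a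
    ...   | yes a = z , there (start∈ w) , head-not-att (cut-at eq (here _) a w e)

    -- The attached vertices of the path separate `h` from an unattached one.
    att-count : k ≤ length (filter att? vs)
    att-count =
      let z , z∈ , ¬a = not-all-att
      in boundary-length kc C (filter att? vs)
           (λ Cu e → map₂ (λ w∈ → ∈-filter⁺ att? w∈ (C⇒att Cu e)) (closed Cu e))
           Ch (out Ch ∘ proj₁ ∘ ∈-filter⁻ att?) (λ Cz → out Cz z∈) (¬a ∘ proj₂ ∘ ∈-filter⁻ att? {xs = vs})

    module Heads {a ws ss} (eq : vs ≡ ws ++ flat ss) (s : Stretch x a ws) (ch : Chain a y ss) where

      cut-vs : ∀ {d} → d ∈ heads ss → Cut x d y vs
      cut-vs d∈ = subst (Cut x _ y) (≡-sym eq) (cut (stretch-walk s) ch d∈)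

      cut₂-vs : ∀ {d d′} → Before d d′ (heads ss) → Cut₂ x d d′ y vs
      cut₂-vs b = subst (Cut₂ x _ _ y) (≡-sym eq) (cut₂ (stretch-walk s) ch b)

      heads-not-att : ∀ {d} → d ∈ heads ss → ¬ Att d
      heads-not-att = head-not-att ∘ cut-vs

      heads∈vs : ∀ {d} → d ∈ heads ss → d ∈ vs
      heads∈vs d∈ = subst (_ ∈_) (≡-sym eq) (∈-++⁺ʳ ws (heads⊆flat ss d∈))

      -- A neighbour of `h` is attached, unlike a head, and an edge between two heads is a crossing
      -- with empty `R`.
      independent-heads : Independent (h ∷ heads ss)
      independent-heads (here refl) (here refl) e = ~-irrefl e
      independent-heads (here refl) (there d∈)  e = heads-not-att d∈ (C⇒att Ch e)
      independent-heads (there d∈)  (here refl) e = heads-not-att d∈ (C⇒att Ch (~-sym e))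
      independent-heads (there d∈)  (there d′∈) e with before-or-after d∈ d′∈
      ... | inj₁ refl     = ~-irrefl e
      ... | inj₂ (inj₁ b) = no-crossing (cut₂-vs b) [] e id [] (λ ())
      ... | inj₂ (inj₂ b) = no-crossing (cut₂-vs b) [] (~-sym e) id [] (λ ())

      unique-h∷heads : Unique (h ∷ heads ss)
      unique-h∷heads = ¬Any⇒All¬ _ (out Ch ∘ heads∈vs) ∷
        unique-heads ss (unique-++⁻ʳ ws (subst Unique eq uniq))

      heads-length : suc (length ss) ≤ k
      heads-length = ≤-trans (s≤s (≤-reflexive (≡-sym (length-map proj₁ ss))))
                       (independent-length≤ st unique-h∷heads independent-heads)

    -- With `y` unattached there would be at most one attached vertex per head, and there are fewer
    -- than `k` heads.
    att-end : Att y
    att-end with parse att? walk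
    ... | a , ws , ss , eq , s , ch with att? y
    ...   | yes att-y = att-y
    ...   | no ¬a     = contradiction
      (≤-trans att-count (≤-trans (≤-reflexive (cong (length ∘ filter att?) eq)) (proj₂ (count≤ att? s ch) ¬a)))
      (<⇒≱ (Heads.heads-length eq s ch))

  record Shape (x y : V) (vs : List V) : Set where
    field
      ss      : List (V × List V)
      eq      : vs ≡ x ∷ flat ss
      chain   : Chain x y ss
      att-x   : Att x
      att-y   : Att y
      size    : suc (length ss) ≡ k
      indep   : Independent (h ∷ heads ss)
      uniqS   : Unique (h ∷ heads ss)

  shape : ∀ {x y vs} → MaximalPath x y vs → Shape x y vs
  shape {x} {y} {vs} m = build (parse att? (MaximalPath.walk m))
    where
    open Maximal m
    -- The argument for `y`, applied to the reversed path.
    att-start : Att x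
    att-start = Maximal.att-end (maximalPath-reverse m)
    build : (∃ λ a → ∃₂ λ ws ss → vs ≡ ws ++ flat ss × Stretch x a ws × Chain a y ss) → Shape x y vs
    build (a , ws , ss , eq , s , ch) with stretch-att s att-start
    ... | refl , refl = record
      { ss = ss ; eq = eq ; chain = ch ; att-x = att-start ; att-y = att-end
      ; size = ≤-antisym heads-length (≤-trans att-count
          (≤-trans (≤-reflexive (cong (length ∘ filter att?) eq)) (proj₁ (count≤ att? s ch))))
      ; indep = independent-heads ; uniqS = unique-h∷heads }
      where open Heads eq s ch

  -- A further vertex `v` would have two neighbours among `h` and the heads. If one is `h`, then `v`
  -- is in `C` and the other, a head, is attached. If both are heads, they give a crossing with
  -- `R = [ v ]`.
  spanning : ∀ {x y vs} → MaximalPath x y vs → Shape x y vs → h ∷ vs ↭ allFin n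
  spanning {x} {y} {vs} m sh = unique-↭-allFin (¬Any⇒All¬ _ (out Ch) ∷ uniq)
    (≤-trans (≤-reflexive (≡-sym length-allFin)) (unique-⊆-length (allFin⁺ n) λ {v} _ → covered v))
    where
    open MaximalPath m
    open Maximal m
    open Shape sh
    open Heads eq end chain

    module _ {v} (v∉ : v ∉ h ∷ vs) where

      ¬C : ∀ {d} → d ∈ heads ss → d ~ v → ¬ C v
      ¬C d∈ e Cv = heads-not-att d∈ (C⇒att Cv (~-sym e))

      C-v : h ~ v → C v
      C-v e = [ id , (λ v∈ → contradiction (there v∈) v∉) ]′ (closed Ch e)

      cross : ∀ {d d′} → Before d d′ (heads ss) → d ~ v → ¬ d′ ~ v
      cross b e e′ = no-crossing (cut₂-vs b) [ v ] e (step (~-sym e′)) ([] ∷ [])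
        λ { (here refl) → v∉ ∘ there , ¬C (before⇒∈ˡ b) e ; (there ()) }

      clash : ∀ {s s′} → s ∈ h ∷ heads ss → s′ ∈ h ∷ heads ss → s ≢ s′ → s ~ v → ¬ s′ ~ v
      clash (here refl) (here refl) s≢s′ _ _   = s≢s′ refl
      clash (here refl) (there d′∈) _ s~v s′~v = ¬C d′∈ s′~v (C-v s~v)
      clash (there d∈)  (here refl) _ s~v s′~v = ¬C d∈ s~v (C-v s′~v)
      clash (there d∈)  (there d′∈) s≢s′ s~v s′~v =
        [ s≢s′ , [ (λ b → cross b s~v s′~v) , (λ b → cross b s′~v s~v) ]′ ]′ (before-or-after d∈ d′∈)

      ∉S : v ∉ h ∷ heads ss
      ∉S (here eq)  = v∉ (here eq)
      ∉S (there d∈) = v∉ (there (heads∈vs d∈))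

      absurd : False
      absurd =
        let s , s′ , s∈ , s′∈ , s≢s′ , s~v , s′~v =
              two-neighbours st uniqS indep (trans (cong suc (length-map proj₁ ss)) size) ∉S
        in clash s∈ s′∈ s≢s′ s~v s′~v

    covered : ∀ v → v ∈ h ∷ vs
    covered v with v ∈? (h ∷ vs)
    ... | yes v∈ = v∈
    ... | no v∉  = ⊥-elim (absurd v∉)

-- Paths missing exactly one vertex.

module NonHamiltonian {n k : ℕ} (G : Graph n) (kc : KConnected G k) (st : STGraph G (suc k) 2)
  {x y : Fin n} (x≢y : x ≢ y) (no-ham : ∀ {ws} → Walk G x y ws → ¬ (ws ↭ allFin n))
  where

  open Graphs G

  open module Ch {h : V} = Chains G (h ~_) public

  -- In each block (v , B), the last vertex of B is the only neighbour of h in v ∷ B.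
  record Config (h : V) (ss : List (V × List V)) : Set where
    field
      walk  : Walk G x y (x ∷ flat ss)
      span  : h ∷ x ∷ flat ss ↭ allFin n
      chain : Chain {h} x y ss
      h~x   : h ~ x
      h~y   : h ~ y
      size  : suc (length ss) ≡ k
      indep : Independent (h ∷ heads ss)
      uniqS : Unique (h ∷ heads ss)
      deg   : k ≤ length (filter (h ~?_) (x ∷ flat ss))

    uniq : Unique (h ∷ x ∷ flat ss)
    uniq = Unique-resp-↭ (↭-sym span) (allFin⁺ n)

    sizeS : length (h ∷ heads ss) ≡ k
    sizeS = trans (cong suc (length-map proj₁ ss)) size

  -- Without a Hamiltonian path, a path missing only `h` is a longest one, so the results on longest
  -- paths apply with `h` as the whole component.
  config : ∀ {h vs} → Walk G x y vs → h ∷ vs ↭ allFin n → ∃ λ ss → vs ≡ x ∷ flat ss × Config h ss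
  config {h} {vs} w p = build shape₀ att-count₀
    where
    C⇒att : ∀ {w a} → w ≡ h → w ~ a → h ~ a
    C⇒att refl e = e

    trivial : ∀ {u w} → u ≡ h → w ≡ h → ∃ λ us → Walk G u w us × Unique us × (∀ {v} → v ∈ us → v ≡ h)
    trivial refl refl = [ h ] , here h , [] ∷ [] , λ { (here eq) → eq ; (there ()) }

    module N = Component G kc st {C = _≡ h} {Att = h ~_} (h ~?_) C⇒att (λ e → h , refl , e) trivial refl

    u : Unique (h ∷ vs)
    u = Unique-resp-↭ (↭-sym p) (allFin⁺ n)

    complete : ∀ v → v ∈ h ∷ vs
    complete v = ∈-resp-↭ (↭-sym p) (∈-allFin v)

    len : suc (length vs) ≡ n
    len = trans (↭-length p) length-allFin

    m : N.MaximalPath x y vs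
    m = record
      { walk = w ; uniq = unique-++⁻ʳ [ h ] u ; x≢y = x≢y
      ; out = λ { refl → Unique[x∷xs]⇒x∉xs u }
      ; closed = λ {_} {v} _ _ → case complete v of λ { (here eq) → inj₁ eq ; (there v∈) → inj₂ v∈ }
      ; max = λ {ws} w′ u′ → ≮⇒≥ λ lt → no-ham w′ (unique-↭-allFin u′ (≤-trans (≤-reflexive (≡-sym len)) lt)) }

    shape₀ : N.Shape x y vs
    shape₀ = N.shape m

    att-count₀ : k ≤ length (filter (h ~?_) vs)
    att-count₀ = N.Maximal.att-count m

    build : N.Shape x y vs → k ≤ length (filter (h ~?_) vs) → ∃ λ ss → vs ≡ x ∷ flat ss × Config h ss
    build sh deg = ss , eq , record
      { walk = subst (Walk G x y) eq w ; span = subst (λ l → h ∷ l ↭ allFin n) eq p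
      ; chain = chain ; h~x = att-x ; h~y = att-y ; size = size ; indep = indep ; uniqS = uniqS
      ; deg = subst (λ l → k ≤ length (filter (h ~?_) l)) eq deg }
      where open N.Shape sh

  record Near (s : V) (ws : List V) : Set where
    constructor near
    field
      walk : Walk G x y ws
      span : s ∷ ws ↭ allFin n

  no-slot : ∀ {s ws} → Near s ws → ¬ Slot s ws
  no-slot (near w p) sl = let _ , w′ , q = slot-insert w sl in no-ham w′ (↭-trans q p)

  module _ {h ss} (c : Config h ss) where
    open Config c

    other-neighbour : ∀ {t} → t ∉ h ∷ heads ss → ∀ v → ∃ λ r → r ∈ h ∷ heads ss × r ≢ v × r ~ t
    other-neighbour t∉ v = 
      let s , s′ , s∈ , s′∈ , s≢s′ , s~t , s′~t = two-neighbours st uniqS indep sizeS t∉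
      in case s ≟ v of λ where
        (yes refl) → s′ , s′∈ , s≢s′ ∘ ≡-sym , s′~t
        (no s≢v)   → s , s∈ , s≢v , s~t

  -- Reroutings that omit a chosen head.

  record Site (h : V) (ls : List (V × List V)) (v : V) (B : List V) (rs : List (V × List V)) : Set where
    field
      {a b}   : V
      left    : Chain {h} x a ls
      h~a     : h ~ a
      a~v     : a ~ v
      stretch : Stretch {h} v b (v ∷ B)
      right   : Chain {h} b y rs
      h~b     : h ~ b

    left-walk : Walk G x a (x ∷ flat ls)
    left-walk = extend (here x) left

  site : ∀ {h ls v B rs} → Config h (ls ++ (v , B) ∷ rs) → Site h ls v B rs
  site {ls = ls} c with chain-++⁻ ls (Config.chain c)
  ... | a , left , seg h~a a~v s right = record
    { left = left ; h~a = h~a ; a~v = a~v ; stretch = s ; right = right ; h~b = chain-end right (Config.h~y c) }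

  head∈S : ∀ {h : V} ls {v B rs} → v ∈ h ∷ heads (ls ++ (v , B) ∷ rs)
  head∈S []       = there (here refl)
  head∈S (l ∷ ls) with head∈S ls
  ... | here eq  = here eq
  ... | there v∈ = there (there v∈)

  ∈S-split : ∀ {h : V} ls {v B rs d} → d ∈ h ∷ heads (ls ++ (v , B) ∷ rs) → d ≡ h ⊎ d ∈ heads ls ⊎ d ≡ v ⊎ d ∈ heads rs
  ∈S-split ls (here eq) = inj₁ eq
  ∈S-split ls {v} {B} {rs} (there d∈) with ∈-++⁻ (heads ls) (subst (_ ∈_) (map-++ proj₁ ls ((v , B) ∷ rs)) d∈)
  ... | inj₁ d∈ls         = inj₂ (inj₁ d∈ls)
  ... | inj₂ (here eq)    = inj₂ (inj₂ (inj₁ eq))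
  ... | inj₂ (there d∈rs) = inj₂ (inj₂ (inj₂ d∈rs))

  body∉S : ∀ {h} ls {v B rs t} → Config h (ls ++ (v , B) ∷ rs) → t ∈ B → t ∉ h ∷ heads (ls ++ (v , B) ∷ rs)
  body∉S ls c t∈ (there d∈) = body∉heads ls (unique-++⁻ʳ (_ ∷ _ ∷ []) (Config.uniq c)) t∈ d∈
  body∉S ls {v} {B} {rs} c t∈ (here refl) = Unique[x∷xs]⇒x∉xs (Config.uniq c)
    (there (subst (_ ∈_) (≡-sym (flat-++ ls)) (∈-++⁺ʳ (flat ls) (there (∈-++⁺ˡ t∈)))))

  h≁head : ∀ {h} ls {v B rs} → Config h (ls ++ (v , B) ∷ rs) → ¬ h ~ v
  h≁head ls c = Config.indep c (here refl) (head∈S ls)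

  -- A block ends in a neighbour of `h`, and its head is not one.
  body-nonempty : ∀ {h} ls {v B rs} → Config h (ls ++ (v , B) ∷ rs) →
    ∃₂ λ w B′ → B ≡ w ∷ B′
  body-nonempty ls c with site {ls = ls} c
  ... | record { stretch = end ; h~b = h~b } = contradiction h~b (h≁head ls c)
  ... | record { stretch = on _ e s } with stretch-∷ s
  ...   | B′ , refl = _ , B′ , refl

  reroute : ∀ {a b c d h α β γ} → Walk G x a α → h ~ a → h ~ c → Walk G b c β → b ~ d → Walk G d y γ →
    Walk G x y (α ++ h ∷ reverse β ++ γ)
  reroute wα h~a h~c wβ b~d wγ = join wα (~-sym h~a) (step h~c (join (walk-reverse wβ) b~d wγ))

  -- Deleting a head v from the path and repairing the gap with h: the vertex w after v
  -- has a neighbour r ≠ v in S, and r lies before v, after v, or is h.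
  omit-head : ∀ {h} ls {v B rs} → Config h (ls ++ (v , B) ∷ rs) →
    ∃ λ ws → Near v ws × (Slot v (x ∷ flat (ls ++ (v , B) ∷ rs)) → Slot v ws)
  omit-head {h} ls {v} {B} {rs} c with body-nonempty ls c
  ... | w , B′ , refl = go (other-neighbour c (body∉S ls c (here refl)) v)
    where
    open Config c
    open Site (site {ls = ls} c)
    γ = w ∷ B′ ++ flat rs

    ss = ls ++ (v , w ∷ B′) ∷ rs

    eq : x ∷ flat ss ≡ (x ∷ flat ls) ++ v ∷ γ
    eq = cong (x ∷_) (flat-++ ls)

    tail : Stretch w _ (w ∷ B′)
    tail = proj₂ (stretch-tail stretch)

    right-walk : Walk G w y γ
    right-walk = extend (stretch-walk tail) right

    v≁ : ∀ {d} → d ∈ h ∷ heads ss → ¬ v ~ d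
    v≁ = indep (head∈S ls)

    -- The path is cut only next to `v` or next to a head `r`. Neither is adjacent to `v`, so a slot
    -- for `v` lies inside a piece and survives, possibly reversed.
    slots : Slot v (x ∷ flat ss) → Slot v (x ∷ flat ls) ⊎ Slot v γ
    slots sl = slot-++⁻ (x ∷ flat ls) ~-irrefl (subst (Slot v) eq sl)

    go : (∃ λ r → r ∈ h ∷ heads ss × r ≢ v × r ~ w) → ∃ λ ws → Near v ws × (Slot v (x ∷ flat ss) → Slot v ws)
    go (r , r∈ , r≢v , r~w) with ∈S-split ls r∈
    ... | inj₁ refl = (x ∷ flat ls) ++ h ∷ γ
      , near (join left-walk (~-sym h~a) (step r~w right-walk))
             (↭-trans (↭-trans (↭-swap-in (x ∷ flat ls) [] γ h v) (↭-reflexive (cong (h ∷_) (≡-sym eq)))) span)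
      , λ sl → [ slot-++⁺ˡ (h ∷ γ) , slot-++⁺ʳ (x ∷ flat ls) ∘ there ]′ (slots sl)
    ... | inj₂ (inj₂ (inj₁ r≡v)) = contradiction r≡v r≢v
    ... | inj₂ (inj₁ r∈ls) = repair (cut (here x) left r∈ls)
      where
      repair : Cut x r _ (x ∷ flat ls) → ∃ λ ws → Near v ws × (Slot v (x ∷ flat ss) → Slot v ws)
      repair (cut-at {p} {q} eq′ l h~c w′ _) with walk-∷ w′
      ... | q′ , refl = p ++ h ∷ reverse q ++ γ
        , near (reroute l h~c h~a w′ r~w right-walk)
               (↭-trans (↭-swap-out p q γ h v)
                 (↭-trans (↭-reflexive (cong (h ∷_) (≡-sym (trans eq (cong (_++ v ∷ γ) eq′))))) span))
        , λ sl → case slots sl of λ where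
            (inj₂ slγ) → slot-++⁺ʳ p (there (slot-++⁺ʳ (reverse q) slγ))
            (inj₁ slα) → case slot-++⁻ p (v≁ r∈) (subst (Slot v) eq′ slα) of λ where
              (inj₁ slp) → slot-++⁺ˡ (h ∷ reverse q ++ γ) slp
              (inj₂ slq) → slot-++⁺ʳ p (there (slot-++⁺ˡ γ (slot-reverse (there {t = r} slq))))
    ... | inj₂ (inj₂ (inj₂ r∈rs)) = repair (cut (stretch-walk tail) right r∈rs)
      where
      repair : Cut w r y γ → ∃ λ ws → Near v ws × (Slot v (x ∷ flat ss) → Slot v ws)
      repair (cut-at {p} {q} eq′ l h~c w′ _) with walk-∷ w′
      ... | q′ , refl = (x ∷ flat ls) ++ h ∷ reverse p ++ q
        , near (reroute left-walk h~a h~c l (~-sym r~w) w′)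
               (↭-trans (↭-swap-in (x ∷ flat ls) p q h v)
                 (↭-trans (↭-reflexive (cong (h ∷_) (≡-sym (trans eq (cong (λ l → (x ∷ flat ls) ++ v ∷ l) eq′))))) span))
        , λ sl → case slots sl of λ where
            (inj₁ slα) → slot-++⁺ˡ (h ∷ reverse p ++ q) slα
            (inj₂ slγ) → case slot-++⁻ p (v≁ r∈) (subst (Slot v) eq′ slγ) of λ where
              (inj₁ slp) → slot-++⁺ʳ (x ∷ flat ls) (there (slot-++⁺ˡ q (slot-reverse slp)))
              (inj₂ slq) → slot-++⁺ʳ (x ∷ flat ls) (there (slot-++⁺ʳ (reverse p) (there {t = r} slq)))

  head-split : ∀ {ss : List (V × List V)} {d} → d ∈ heads ss → ∃₂ λ ls B → ∃ λ rs → ss ≡ ls ++ (d , B) ∷ rs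
  head-split {(v , B) ∷ ss} (here refl) = [] , B , ss , refl
  head-split {(v , B) ∷ ss} (there d∈) =
    let ls , B′ , rs , eq = head-split d∈ in (v , B) ∷ ls , B′ , rs , cong ((v , B) ∷_) eq

  omit : ∀ {h ss s} → Config h ss → s ∈ h ∷ heads ss → ∃ λ ws → Near s ws × (Slot s (x ∷ flat ss) → Slot s ws)
  omit c (here refl) = _ , near (Config.walk c) (Config.span c) , id
  omit c (there s∈) with head-split s∈
  ... | ls , B , rs , refl = omit-head ls c

  -- Some path misses only `s` and keeps the slot; inserting `s` there would make it Hamiltonian.
  no-common-neighbour : ∀ {h ss s} → Config h ss → s ∈ h ∷ heads ss → ¬ Slot s (x ∷ flat ss)
  no-common-neighbour c s∈ sl = let _ , nr , f = omit c s∈ in no-slot nr (f sl)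

  -- The heads in cyclic order along the path, starting after the block of v; h comes first because
  -- only the last vertex of that block is adjacent to h.
  order : V → List (V × List V) → V → List (V × List V) → List V
  order h ls v rs = h ∷ heads rs ++ heads ls ++ [ v ]

  order-↭ : ∀ h ls v B rs → h ∷ heads (ls ++ (v , B) ∷ rs) ↭ order h ls v rs
  order-↭ h ls v B rs = prep h (↭-trans (↭-reflexive (map-++ proj₁ ls ((v , B) ∷ rs)))
    (↭-rotate (heads ls) [ v ] (heads rs)))

  -- Neighbours move backwards along a block.

  module Descent {h : V} (ls : List (V × List V)) {v : V} (B₁ : List V) {t t′ : V} (B₂ : List V) (rs : List (V × List V))
    (c : Config h (ls ++ (v , B₁ ++ t ∷ t′ ∷ B₂) ∷ rs)) where

    open Config c
    open Site (site {ls = ls} c)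

    ss : List (V × List V)
    ss = ls ++ (v , B₁ ++ t ∷ t′ ∷ B₂) ∷ rs

    -- The path is broken between `t` and `t′`, which makes `t` the end of a truncated last block.
    ls⁺ : List (V × List V)
    ls⁺ = ls ++ [ (v , B₁ ++ [ t ]) ]

    pieces : Stretch {h} v t (v ∷ B₁ ++ [ t ]) × t ~ t′ × Stretch {h} t′ b (t′ ∷ B₂)
    pieces = stretch-split (v ∷ B₁) stretch

    left⁺ : Chain {h} x t ls⁺
    left⁺ = chain-++⁺ left (seg h~a a~v (proj₁ pieces) [])

    t′-walk : Walk G t′ b (t′ ∷ B₂)
    t′-walk = stretch-walk (proj₂ (proj₂ pieces))

    path-eq : x ∷ flat ss ≡ (x ∷ flat ls⁺) ++ (t′ ∷ B₂ ++ flat rs)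
    path-eq = cong (x ∷_) (begin
      flat ss                                                         ≡⟨ flat-++ ls ⟩
      flat ls ++ v ∷ (B₁ ++ t ∷ t′ ∷ B₂) ++ flat rs                   ≡⟨ cong (λ l → flat ls ++ v ∷ l) (++-assoc B₁ (t ∷ t′ ∷ B₂) (flat rs)) ⟩
      flat ls ++ v ∷ B₁ ++ t ∷ t′ ∷ B₂ ++ flat rs                     ≡⟨ cong (λ l → flat ls ++ v ∷ l) (++-assoc B₁ [ t ] (t′ ∷ B₂ ++ flat rs)) ⟨
      flat ls ++ v ∷ (B₁ ++ [ t ]) ++ t′ ∷ B₂ ++ flat rs              ≡⟨ ++-assoc (flat ls) (v ∷ B₁ ++ [ t ]) _ ⟨
      (flat ls ++ v ∷ B₁ ++ [ t ]) ++ t′ ∷ B₂ ++ flat rs              ≡⟨ cong (_++ (t′ ∷ B₂ ++ flat rs)) (cong (λ l → flat ls ++ v ∷ l) (++-identityʳ (B₁ ++ [ t ]))) ⟨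
      (flat ls ++ v ∷ (B₁ ++ [ t ]) ++ []) ++ t′ ∷ B₂ ++ flat rs      ≡⟨ cong (_++ (t′ ∷ B₂ ++ flat rs)) (flat-++ ls) ⟨
      flat ls⁺ ++ t′ ∷ B₂ ++ flat rs                                  ∎)
      where open ≡-Reasoning

    impossible : ∀ {ws αs βs} → x ∷ flat ls⁺ ≡ αs → t′ ∷ B₂ ++ flat rs ≡ βs → Walk G x y ws → ¬ (ws ↭ h ∷ αs ++ βs)
    impossible refl refl w p = no-ham w (↭-trans p (↭-trans (↭-reflexive (cong (h ∷_) (≡-sym path-eq))) span))

    -- Otherwise go from `x` to `t`, from `s` to the vertex before `s′`, to `h`, from the vertex
    -- before `s` back to `t′`, and from `s′` to `y`.
    both-after : ∀ {s s′} → Before s s′ (heads rs) → s ~ t → ¬ s′ ~ t′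
    both-after b s~t s′~t′ with cut₂ t′-walk right b
    ... | cut-at₂ {p} {q} {r} eq l h~c m h~c′ w =
      impossible refl eq
        (join (extend (here x) left⁺) (~-sym s~t) (join m (~-sym h~c′) (step h~c (join (walk-reverse l) (~-sym s′~t′) w))))
        (↭-late (x ∷ flat ls⁺) p q r h)

    -- Otherwise go from `x` to the vertex before `s`, to `h`, from the vertex before `s′` back to
    -- `s`, from `t` back to `s′`, and from `t′` to `y`.
    both-before : ∀ {s s′} → Before s s′ (heads ls⁺) → s ~ t → ¬ s′ ~ t′
    both-before b s~t s′~t′ with cut₂ (here x) left⁺ b
    ... | cut-at₂ {p} {q} {r} eq l h~c m h~c′ w =
      impossible eq refl
        (join l (~-sym h~c) (step h~c′ (join (walk-reverse m) s~t (join (walk-reverse w) s′~t′ (extend t′-walk right)))))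
        (↭-early p q r (t′ ∷ B₂ ++ flat rs) h)

    -- Otherwise go from `x` to the vertex before `s′`, to `h`, from the vertex before `s` back to
    -- `t′`, from `s′` to `t`, and from `s` to `y`.
    either-side : ∀ {s s′} → s ∈ heads rs → s′ ∈ heads ls⁺ → s ~ t → ¬ s′ ~ t′
    either-side s∈ s′∈ s~t s′~t′ with cut t′-walk right s∈ | cut (here x) left⁺ s′∈
    ... | cut-at {r} {z} eq l h~c w _ | cut-at {p} {q} eq′ l′ h~c′ w′ _ =
      impossible eq′ eq
        (join l′ (~-sym h~c′) (step h~c (join (walk-reverse l) (~-sym s′~t′) (join w′ (~-sym s~t) w))))
        (↭-across p q r z h)

    heads-ls⁺ : heads ls⁺ ≡ heads ls ++ [ v ]
    heads-ls⁺ = map-++ proj₁ ls _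

    -- Equal neighbours would form a slot. If `s` came first, it could not be `h`, as `t` does not
    -- end its block, and the three reroutings exclude all other positions.
    descent : ∀ {s s′} → s ∈ order h ls v rs → s′ ∈ order h ls v rs → s ~ t → s′ ~ t′ → Before s′ s (order h ls v rs)
    descent {s} {s′} s∈ s′∈ s~t s′~t′ with before-or-after s∈ s′∈
    ... | inj₂ (inj₂ b) = b
    ... | inj₁ refl = contradiction slot (no-common-neighbour c (∈-resp-↭ (↭-sym (order-↭ h ls v _ rs)) s∈))
      where
      slot : Slot s (x ∷ flat ss)
      slot = subst (Slot s) (≡-sym (cong (x ∷_) (trans (flat-++ ls) (cong (λ l → flat ls ++ v ∷ l) (++-assoc B₁ (t ∷ t′ ∷ B₂) (flat rs))))))
        (there (slot-++⁺ʳ (flat ls) (there (slot-++⁺ʳ B₁ (here s~t s′~t′)))))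
    ... | inj₂ (inj₁ (here _)) = contradiction s~t (stretch-not-att (v ∷ B₁) stretch)
    ... | inj₂ (inj₁ (there b)) with before-++⁻ (heads rs) b
    ...   | inj₁ b′ = contradiction s′~t′ (both-after b′ s~t)
    ...   | inj₂ (inj₁ b′) = contradiction s′~t′ (both-before (subst (Before s s′) (≡-sym heads-ls⁺) b′) s~t)
    ...   | inj₂ (inj₂ (s∈rs , s′∈ls)) = contradiction s′~t′ (either-side s∈rs (subst (s′ ∈_) (≡-sym heads-ls⁺) s′∈ls) s~t)

  module Block {h : V} (ls : List (V × List V)) (v : V) (B : List V) (rs : List (V × List V))
    (c : Config h (ls ++ (v , B) ∷ rs)) where

    open Config c

    O : List V
    O = order h ls v rs

    O↭S : h ∷ heads (ls ++ (v , B) ∷ rs) ↭ O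
    O↭S = order-↭ h ls v B rs

    uniqO : Unique O
    uniqO = Unique-resp-↭ O↭S uniqS

    -- The neighbour of `t′` is recorded to serve as the middle term in transitivity.
    Descends : V → V → Set
    Descends t t′ = (∃ λ s → s ∈ O × s ~ t′) ×
      (∀ {s s′} → s ∈ O → s′ ∈ O → s ~ t → s′ ~ t′ → Before s′ s O)

    descends-trans : ∀ {t t′ t″} → Descends t t′ → Descends t′ t″ → Descends t t″
    descends-trans ((m , m∈ , m~t′) , f) (e , g) =
      e , λ s∈ s″∈ s~t s″~t″ → before-trans uniqO (g m∈ s″∈ m~t′ s″~t″) (f s∈ m∈ s~t m~t′)

    neighbour≢ : ∀ {t} → t ∈ B → ∀ u → ∃ λ s → s ∈ O × s ≢ u × s ~ t
    neighbour≢ t∈ u = let s , s∈ , s≢u , s~t = other-neighbour c (body∉S ls c t∈) u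
                      in s , ∈-resp-↭ O↭S s∈ , s≢u , s~t

    descending : AllPairs Descends B
    descending = Linked⇒AllPairs descends-trans (linked-of-splits B λ where
      B₁ {t} {t′} B₂ refl →
        (let s , s∈ , _ , s~t′ = neighbour≢ (∈-++⁺ʳ B₁ (there (here refl))) h in s , s∈ , s~t′) ,
        Descent.descent ls B₁ B₂ rs c)

    -- Two neighbours of `s` in the body would put `s` before itself in the cyclic order, and the
    -- head is excluded by independence.
    at-most-one : ∀ {s} → s ∈ h ∷ heads (ls ++ (v , B) ∷ rs) → length (filter (s ~?_) (v ∷ B)) ≤ 1
    at-most-one {s} s∈ = filter-≤1 (s ~?_)
      (All.universal (λ _ (s~v , _) → indep s∈ (head∈S ls) s~v) B ∷
       AllPairs.map (λ (_ , f) (e , e′) → before-irrefl uniqO (f s∈O s∈O e e′)) descending)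
      where
      s∈O : s ∈ O
      s∈O = ∈-resp-↭ O↭S s∈

  -- Exactly one neighbour in each block.

  module _ {h ss s} (c : Config h ss) (s∈ : s ∈ h ∷ heads ss) where
    open Config c

    -- Since `s` is the vertex missed by another path, it plays the role of `h` for that path.
    omitted : ∃ λ vs → s ∷ vs ↭ allFin n × s ~ x × k ≤ length (filter (s ~?_) vs)
    omitted with omit c s∈
    ... | ws , near w p , _ with config w p
    ...   | _ , refl , c′ = ws , p , Config.h~x c′ , Config.deg c′

    s~x : s ~ x
    s~x = let _ , _ , e , _ = omitted in e

    private
      count : List V → ℕ
      count = length ∘ filter (s ~?_)

      count-∷≤ : ∀ u ws → count ws ≤ count (u ∷ ws) × count (u ∷ ws) ≤ suc (count ws)
      count-∷≤ u ws with s ~? u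
      ... | yes _ = n≤1+n _ , ≤-refl
      ... | no _  = ≤-refl , n≤1+n _

      count-skip : ∀ {u} ws → ¬ s ~ u → count (u ∷ ws) ≡ count ws
      count-skip {u} ws ¬e with s ~? u
      ... | yes e = contradiction e ¬e
      ... | no _  = refl

    -- Of the at least `k` neighbours of `s`, none is `h` and at most one is `x`.
    enough : length ss ≤ count (flat ss)
    enough =
      let vs , p , _ , deg′ = omitted
      in s≤s⁻¹ (begin
        suc (length ss)          ≡⟨ size ⟩
        k                        ≤⟨ deg′ ⟩
        count vs                 ≤⟨ proj₁ (count-∷≤ s vs) ⟩
        count (s ∷ vs)           ≡⟨ ↭-length (filter-↭ (s ~?_) (↭-trans p (↭-sym span))) ⟩
        count (h ∷ x ∷ flat ss)  ≡⟨ count-skip (x ∷ flat ss) (indep s∈ (here refl)) ⟩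
        count (x ∷ flat ss)      ≤⟨ proj₂ (count-∷≤ x (flat ss)) ⟩
        suc (count (flat ss))    ∎)
      where open ≤-Reasoning

    -- The upper bound of one per block is met in total, hence in every block, and never by a head.
    block-neighbour : ∀ {v B} → (v , B) ∈ ss → ∃ λ t → t ∈ B × s ~ t
    block-neighbour {v} {B} m with filter-member (s ~?_) (v ∷ B) (count-flat-tight (s ~?_) one enough m)
      where
      one : ∀ {v B} → (v , B) ∈ ss → count (v ∷ B) ≤ 1
      one {v} {B} m with ∈-∃++ m
      ... | ls , rs , refl = Block.at-most-one ls v B rs c s∈
    ... | t , there t∈ , s~t       = t , t∈ , s~t
    ... | t , here refl , s~v with ∈-∃++ m
    ...   | ls , rs , refl = contradiction s~v (indep s∈ (head∈S ls))

  -- If the neighbour of `q` in the block came after `w`, descent would put every neighbour of `w`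
  -- in the order after `q`. Only `v` is there, but `w` also has a neighbour other than `v`.
  penultimate-neighbour : ∀ {h} ls {v w B rs q} O′ → (c : Config h (ls ++ (v , w ∷ B) ∷ rs)) →
    order h ls v rs ≡ O′ ++ q ∷ v ∷ [] → q ~ w
  penultimate-neighbour {h} ls {v} {w} {B} {rs} {q} O′ c eq =
    pick (block-neighbour c (∈-resp-↭ (↭-sym O↭S) q∈O) (∈-insert ls))
    where
    open Block ls v (w ∷ B) rs c
    q∈O : q ∈ O
    q∈O = subst (q ∈_) (≡-sym eq) (∈-insert O′)
    pick : (∃ λ t → t ∈ w ∷ B × q ~ t) → q ~ w
    pick (_ , here refl , q~w) = q~w
    pick (t , there t∈ , q~t) with neighbour≢ (here refl) v | descending
    ... | r , r∈ , r≢v , r~w | ds ∷ _ =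
      contradiction (before-penultimate O′ (subst Unique eq uniqO)
        (subst (Before q r) eq (proj₂ (All.lookup ds t∈) r∈ q∈O r~w q~t))) r≢v

-- Exchanging `h` until every body is a single vertex.

module Ladders {n k : ℕ} (G : Graph n) (kc : KConnected G k) (st : STGraph G (suc k) 2)
  {x y : Fin n} (x≢y : x ≢ y) (no-ham : ∀ {ws} → Walk G x y ws → ¬ (ws ↭ allFin n))
  where

  open Graphs G
  open NonHamiltonian G kc st x≢y no-ham

  singles : List (V × V) → List (V × List V)
  singles = map (λ (v , b) → v , [ b ])

  -- Here `s` is adjacent to every second vertex of an initial part. On a path missing only `s`,
  -- this makes the first `p` bodies single vertices.
  data Ladder (s : V) : ℕ → List V → Set where
    base : ∀ {a ws} → s ~ a → Ladder s 0 (a ∷ ws)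
    rung : ∀ {p a u b ws} → s ~ a → Ladder s p (b ∷ ws) → Ladder s (suc p) (a ∷ u ∷ b ∷ ws)

  ladder-start : ∀ {s p a ws} → Ladder s p (a ∷ ws) → s ~ a
  ladder-start (base e)   = e
  ladder-start (rung e _) = e

  -- A block ends at the first neighbour of `h` after its head, and a rung puts one right there.
  ladder⇒singles : ∀ {h a} p ss → Ladder h p (a ∷ flat ss) → Chain {h} a y ss → h ~ y →
    (∀ {d} → d ∈ heads ss → ¬ h ~ d) → ∃₂ λ ps rs → ss ≡ singles ps ++ rs × length ps ≡ p
  ladder⇒singles zero ss _ _ _ _ = [] , ss , refl , refl
  ladder⇒singles (suc p) [] () _ _ _
  ladder⇒singles (suc p) ((v , []) ∷ ss) _ (seg _ _ end c) h~y ¬h~ = contradiction (chain-end c h~y) (¬h~ (here refl))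
  ladder⇒singles (suc p) ((v , b ∷ B) ∷ ss) (rung _ l) (seg _ _ s c) h~y ¬h~
    with stretch-att (proj₂ (stretch-tail s)) (ladder-start l)
  ... | refl , refl =
    let ps , rs , eq , len = ladder⇒singles p ss l c h~y (¬h~ ∘ there)
    in (v , b) ∷ ps , rs , cong ((v , [ b ]) ∷_) eq , cong suc len

  ladder-singles : ∀ {q a m ws} ps → q ~ a → (∀ {v b} → (v , b) ∈ ps → q ~ b) →
    (∀ {b} → q ~ b → Ladder q m (b ∷ ws)) → Ladder q (length ps + m) (a ∷ flat (singles ps) ++ ws)
  ladder-singles []             q~a _   f = f q~a
  ladder-singles ((v , b) ∷ ps) q~a q~b f = rung q~a (ladder-singles ps (q~b (here refl)) (q~b ∘ there) f)

  singles-neighbour : ∀ {h ps rs q} → Config h (singles ps ++ rs) → q ∈ h ∷ heads (singles ps ++ rs) →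
    ∀ {v b} → (v , b) ∈ ps → q ~ b
  singles-neighbour c q∈ {v} {b} m with block-neighbour c q∈ (∈-++⁺ˡ (∈-map⁺ _ m))
  ... | _ , here refl , e = e

  -- h takes the place of q. On the new path, which misses q, also v ∷ w ends up as a block, since q ~ w.
  climb : ∀ {h ps q b v w B rs} → Config h (singles ps ++ (q , [ b ]) ∷ (v , w ∷ B) ∷ rs) →
    ∃ λ ws → Near q ws × Ladder q (length ps + 2) ws
  climb {h} {ps} {q} {b} {v} {w} {B} {rs} c = swap (chain-++⁻ (singles ps) (Config.chain c))
    where
    α = x ∷ flat (singles ps)
    γ = b ∷ v ∷ w ∷ B ++ flat rs

    q∈ : q ∈ h ∷ heads (singles ps ++ (q , [ b ]) ∷ (v , w ∷ B) ∷ rs)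
    q∈ = head∈S (singles ps)

    assoc : singles ps ++ (q , [ b ]) ∷ (v , w ∷ B) ∷ rs ≡ (singles ps ++ [ (q , [ b ]) ]) ++ (v , w ∷ B) ∷ rs
    assoc = ≡-sym (++-assoc (singles ps) [ (q , [ b ]) ] ((v , w ∷ B) ∷ rs))

    -- In the cyclic order that ends with `v`, the head of the preceding block comes just before
    -- `v`.
    q~w : q ~ w
    q~w = penultimate-neighbour (singles ps ++ [ (q , [ b ]) ]) (h ∷ heads rs ++ heads (singles ps)) (subst (Config h) assoc c)
      (cong (h ∷_) (begin
        heads rs ++ heads (singles ps ++ [ (q , [ b ]) ]) ++ [ v ]    ≡⟨ cong (λ l → heads rs ++ l ++ [ v ]) (map-++ proj₁ (singles ps) _) ⟩
        heads rs ++ (heads (singles ps) ++ [ q ]) ++ [ v ]            ≡⟨ cong (heads rs ++_) (++-assoc (heads (singles ps)) [ q ] [ v ]) ⟩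
        heads rs ++ heads (singles ps) ++ q ∷ v ∷ []                  ≡⟨ ++-assoc (heads rs) (heads (singles ps)) _ ⟨
        (heads rs ++ heads (singles ps)) ++ q ∷ v ∷ []                ∎))
      where open ≡-Reasoning

    q~b : q ~ b
    q~b with block-neighbour c q∈ (∈-insert (singles ps))
    ... | _ , here refl , e = e

    swap : (∃ λ a → Chain {h} x a (singles ps) × Chain {h} a y ((q , [ b ]) ∷ (v , w ∷ B) ∷ rs)) →
      ∃ λ ws → Near q ws × Ladder q (length ps + 2) ws
    swap (a , left , seg h~a _ (on _ _ end) (seg h~b b~v s right)) =
      α ++ h ∷ γ
      , near (join (extend (here x) left) (~-sym h~a) (step h~b (step b~v (extend (stretch-walk s) right))))
             (↭-trans (↭-swap-in α [] γ h q)
               (↭-trans (↭-reflexive (cong (λ l → h ∷ x ∷ l) (≡-sym (flat-++ (singles ps))))) (Config.span c)))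
      , ladder-singles ps (s~x c q∈) (singles-neighbour c q∈) (λ e → rung e (rung q~b (base q~w)))

  -- With two or more blocks, the path x, h, first block reversed, w, … omits v′, and v′ is adjacent
  -- to x and to the end of the first block.
  first-rung : 2 ≤ k → ∀ {h ss} → Config h ss → ∃₂ λ s ws → Near s ws × Ladder s 1 ws
  first-rung 2≤k {ss = []} c = contradiction (Config.size c) (<⇒≢ 2≤k)
  first-rung _ {h} {(v , B) ∷ []} c with body-nonempty [] c
  ... | w , B′ , refl = h , x ∷ v ∷ w ∷ B′ ++ [] , near (Config.walk c) (Config.span c)
    , rung (Config.h~x c) (base (penultimate-neighbour [] [] c refl))
  first-rung _ {h} {(v , B) ∷ (v′ , B″) ∷ rs} c with body-nonempty [ (v , B) ] c
  ... | w , B′ , refl = go (Config.chain c)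
    where
    v~w : v ~ w
    v~w = penultimate-neighbour [ (v , B) ] (h ∷ heads rs) c refl

    v′∈ : v′ ∈ h ∷ v ∷ v′ ∷ heads rs
    v′∈ = there (there (here refl))

    go : Chain {h} x y ((v , B) ∷ (v′ , w ∷ B′) ∷ rs) → ∃₂ λ s ws → Near s ws × Ladder s 1 ws
    go (seg {b = e} h~x _ s (seg h~e e~v′ s′ right)) = v′ , x ∷ h ∷ reverse (v ∷ B) ++ γ
      , near (reroute (here x) h~x h~e (stretch-walk s) v~w (extend (stretch-walk (proj₂ (stretch-tail s′))) right))
             (↭-trans (↭-swap-out [ x ] (v ∷ B) γ h v′) (Config.span c))
      , ladder (walk-∷ (walk-reverse (stretch-walk s)))
      where
      γ = w ∷ B′ ++ flat rs
      ladder : (∃ λ l → reverse (v ∷ B) ≡ e ∷ l) → Ladder v′ 1 (x ∷ h ∷ reverse (v ∷ B) ++ γ)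
      ladder (l , eq) = subst (λ r → Ladder v′ 1 (x ∷ h ∷ r ++ γ)) (≡-sym eq) (rung (s~x c v′∈) (base (~-sym e~v′)))

  blocks : ∀ {h} ps {rs} → Config h (singles ps ++ rs) → suc (length ps + length rs) ≡ k
  blocks ps {rs} c = trans (cong suc (trans (cong (_+ length rs) (≡-sym (length-map _ ps)))
    (≡-sym (length-++ (singles ps))))) (Config.size c)

  length-∷ʳ : ∀ (ps : List (V × V)) {z} → length (ps ∷ʳ z) ≡ suc (length ps)
  length-∷ʳ ps = trans (length-++ ps) (+-comm (length ps) 1)

  -- The number `j` of blocks beyond the ladder drops with each climb. At least one rung is
  -- required, because a climb exchanges `h` with the head of the last block on the ladder.
  all-singles : ∀ j {p h ws} → suc (suc p + j) ≡ k → Near h ws → Ladder h (suc p) ws → ∃₂ λ h ps → Config h (singles ps)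
  climb-all : ∀ j {h} ps q b rs → Config h (singles (ps ∷ʳ (q , b)) ++ rs) → length rs ≡ j → ∃₂ λ h ps → Config h (singles ps)

  all-singles j {p} eq (near w sp) l with config w sp
  ... | ss , refl , c with ladder⇒singles (suc p) ss l (Config.chain c) (Config.h~y c) (Config.indep c (here refl) ∘ there)
  ...   | ps , rs , refl , len with initLast ps
  all-singles j {p} eq _ _ | _ , refl , _ | _ , _ , refl , () | []
  all-singles j {p} eq _ _ | _ , refl , c | _ , rs , refl , len | ps ∷ʳ′ (q , b) =
    climb-all j ps q b rs c (+-cancelˡ-≡ (suc p) _ _ (trans (cong (_+ length rs) (≡-sym len))
      (suc-injective (trans (blocks (ps ∷ʳ (q , b)) c) (≡-sym eq)))))

  climb-all _ ps q b [] c _ = _ , ps ∷ʳ (q , b) , subst (Config _) (++-identityʳ _) c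
  climb-all (suc j) {h} ps q b ((v , B) ∷ rs) c len with body-nonempty (singles (ps ∷ʳ (q , b))) c
  ... | w , B′ , refl =
    let ws , nr , l = climb {ps = ps} (subst (Config h) assoc c)
    in all-singles j size′ nr (subst (λ m → Ladder q m ws) (+-comm (length ps) 2) l)
    where
    assoc : singles (ps ∷ʳ (q , b)) ++ (v , w ∷ B′) ∷ rs ≡ singles ps ++ (q , [ b ]) ∷ (v , w ∷ B′) ∷ rs
    assoc = trans (cong (_++ (v , w ∷ B′) ∷ rs) (map-++ _ ps [ (q , b) ])) (++-assoc (singles ps) _ _)
    size′ : suc (suc (suc (length ps)) + j) ≡ k
    size′ = trans (cong suc (trans (cong (λ m → suc (m + j)) (≡-sym (length-∷ʳ ps))) (≡-sym (trans (cong (length (ps ∷ʳ (q , b)) +_) len) (+-suc _ j)))))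
              (blocks (ps ∷ʳ (q , b)) c)

  reach-singles : 2 ≤ k → ∀ {h vs} → Near h vs → ∃₂ λ h ps → Config h (singles ps)
  reach-singles 2≤k@(s≤s (s≤s {n = j} z≤n)) (near w sp) with config w sp
  ... | _ , refl , c with first-rung 2≤k c
  ...   | _ , _ , nr , l = all-singles j refl nr l

  -- Reading off the join once all bodies are single vertices.

  module _ {h ps} (c : Config h (singles ps)) where
    open Config c

    S T : List V
    S = h ∷ map proj₁ ps
    T = x ∷ map proj₂ ps

    S≡ : S ≡ h ∷ heads (singles ps)
    S≡ = cong (h ∷_) (map-∘ {g = proj₁} ps)

    singles-independent : Independent S
    singles-independent rewrite S≡ = indep

    singles-complete : ∀ {s t} → s ∈ S → t ∈ T → s ~ t
    singles-complete {s} {t} s∈ t∈ = go (subst (s ∈_) S≡ s∈) t∈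
      where
      go : s ∈ h ∷ heads (singles ps) → t ∈ T → s ~ t
      go s∈ (here refl) = s~x c s∈
      go s∈ (there t∈) with ∈-map⁻ proj₂ t∈
      ... | (v , b) , m , refl with block-neighbour c s∈ (∈-map⁺ _ m)
      ...   | _ , here refl , e = e

    singles-span : S ++ T ↭ allFin n
    singles-span = ↭-trans (prep h (↭-trans (shift x (map proj₁ ps) (map proj₂ ps)) (prep x (flat-singles ps)))) span
      where
      flat-singles : ∀ ps → map proj₁ ps ++ map proj₂ ps ↭ flat (singles ps)
      flat-singles []             = ↭-refl
      flat-singles ((v , b) ∷ ps) = prep v (↭-trans (shift b (map proj₁ ps) (map proj₂ ps)) (prep b (flat-singles ps)))

    length-S : length S ≡ k
    length-S = trans (cong length S≡) sizeS

    length-T : length T ≡ k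
    length-T = trans (cong suc (trans (length-map proj₂ ps) (≡-sym (length-map _ ps)))) size

-- Deciding whether the graph is a join, and the isomorphism.

module Joins {n : ℕ} (G : Graph n) where

  open Graphs G

  -- Phrased with vertex lists and `All`, so that a finite search over lists decides it.
  IsJoin : List V → List V → Set
  IsJoin S T = Unique (S ++ T) × (∀ v → v ∈ S ++ T) ×
    All (λ s → All (λ s′ → ¬ s ~ s′) S) S × All (λ s → All (s ~_) T) S

  JoinOf : ℕ → Set
  JoinOf k = ∃ λ S → length S ≡ k × ∃ λ T → length T ≡ k × IsJoin S T

  joinOf? : ∀ k → Dec (JoinOf k)
  joinOf? k = anyList? k λ S → anyList? k λ T →
    unique? _≟_ (S ++ T) ×-dec all? (_∈? (S ++ T)) ×-dec
    All.all? (λ s → All.all? (λ s′ → ¬? (s ~? s′)) S) S ×-dec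
    All.all? (λ s → All.all? (s ~?_) T) S

  record Enumeration (k : ℕ) (l : List V) : Set where
    field
      at         : Fin k → V
      at∈        : ∀ i → at i ∈ l
      surjective : ∀ {v} → v ∈ l → ∃ λ i → at i ≡ v
      injective  : ∀ {i j} → at i ≡ at j → i ≡ j

  enumeration : ∀ {k l} → length l ≡ k → Unique l → Enumeration k l
  enumeration {l = l} refl u = record
    { at = List.lookup l ; at∈ = ∈-lookup
    ; surjective = λ v∈ → index v∈ , ≡-sym (lookup-index v∈) ; injective = lookup-injective u }
    where
    lookup-injective : ∀ {l : List V} → Unique l → ∀ {i j} → List.lookup l i ≡ List.lookup l j → i ≡ j
    lookup-injective {_ ∷ _} u {zero}  {zero}  _  = refl
    lookup-injective {_ ∷ _} u {zero}  {suc j} eq = contradiction eq (∉∷⇒≢ u (∈-lookup j))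
    lookup-injective {_ ∷ _} u {suc i} {zero}  eq = contradiction (≡-sym eq) (∉∷⇒≢ u (∈-lookup i))
    lookup-injective {_ ∷ _} (_ ∷ u) {suc i} {suc j} eq = cong suc (lookup-injective u eq)

  -- The arbitrary graph of the join is the one that `G` induces on `T`.
  join-≅ : ∀ {k} → JoinOf k → ∃ λ (H : Graph k) → G ≅ join-kK1 k H
  join-≅ {k} (S , lenS , T , lenT , u , complete , ind , full) = H , bijection , preserves
    where
    open Enumeration (enumeration lenS (unique-++⁻ˡ S u)) renaming (at to σ; at∈ to σ∈; surjective to σ-sur; injective to σ-inj)
    open Enumeration (enumeration lenT (unique-++⁻ʳ S u)) renaming (at to τ; at∈ to τ∈; surjective to τ-sur; injective to τ-inj)

    H : Graph k
    H = record { adj = λ i j → adj G (τ i) (τ j) ; sym = λ i j → Graph.sym G (τ i) (τ j) ; irrefl = λ i → Graph.irrefl G (τ i) }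

    place : Fin k ⊎ Fin k → V
    place = [ σ , τ ]′

    place-injective : ∀ p q → place p ≡ place q → p ≡ q
    place-injective (inj₁ i) (inj₁ j) eq = cong inj₁ (σ-inj eq)
    place-injective (inj₂ i) (inj₂ j) eq = cong inj₂ (τ-inj eq)
    place-injective (inj₁ i) (inj₂ j) eq = contradiction (subst (_∈ T) (≡-sym eq) (τ∈ j)) (unique-++-disjoint S u (σ∈ i))
    place-injective (inj₂ i) (inj₁ j) eq = contradiction (subst (_∈ T) eq (τ∈ i)) (unique-++-disjoint S u (σ∈ j))

    place-surjective : ∀ v → ∃ λ p → place p ≡ v
    place-surjective v with ∈-++⁻ S (complete v)
    ... | inj₁ v∈ = let i , eq = σ-sur v∈ in inj₁ i , eq
    ... | inj₂ v∈ = let i , eq = τ-sur v∈ in inj₂ i , eq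

    from : Fin (k + k) → V
    from = place ∘ splitAt k

    to : V → Fin (k + k)
    to v = Fin.join k k (proj₁ (place-surjective v))

    from∘to : ∀ v → from (to v) ≡ v
    from∘to v = trans (cong place (splitAt-join k k (proj₁ (place-surjective v)))) (proj₂ (place-surjective v))

    from-injective : ∀ {i j} → from i ≡ from j → i ≡ j
    from-injective {i} {j} eq = trans (≡-sym (join-splitAt k k i))
      (trans (cong (Fin.join k k) (place-injective (splitAt k i) (splitAt k j) eq)) (join-splitAt k k j))

    bijection : Fin n ↔ Fin (k + k)
    bijection = mk↔ₛ′ to from (λ i → from-injective (from∘to (from i))) from∘to

    adj-from : ∀ i j → adj G (from i) (from j) ≡ joinAdj H i j
    adj-from i j with splitAt k i | splitAt k j
    ... | inj₁ a | inj₁ b = Bool.¬-not (All.lookup (All.lookup ind (σ∈ a)) (σ∈ b))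
    ... | inj₁ a | inj₂ b = All.lookup (All.lookup full (σ∈ a)) (τ∈ b)
    ... | inj₂ a | inj₁ b = ~-sym (All.lookup (All.lookup full (σ∈ b)) (τ∈ a))
    ... | inj₂ a | inj₂ b = refl

    preserves : ∀ u v → adj G u v ≡ joinAdj H (to u) (to v)
    preserves u v = trans (≡-sym (cong₂ (adj G) (from∘to u) (from∘to v))) (adj-from (to u) (to v))

-- From a missing Hamiltonian path to the join.

module NonHamiltonianPair {n k : ℕ} (G : Graph n) (2≤k : 2 ≤ k) (kc : KConnected G k) (st : STGraph G (suc k) 2)
  {x y : Fin n} (x≢y : x ≢ y) (¬ham : ¬ HamiltonianPath G x y)
  where

  open Graphs G
  open Joins G

  no-ham : ∀ {ws} → Walk G x y ws → ¬ (ws ↭ allFin n)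
  no-ham w p = ¬ham (_ , w , Unique-resp-↭ (↭-sym p) (allFin⁺ n) , λ v → ∈-resp-↭ (↭-sym p) (∈-allFin v))

  open NonHamiltonian G kc st x≢y no-ham using (Near; near)
  open Ladders G kc st x≢y no-ham

  near⇒join : ∀ {h ws} → Near h ws → JoinOf k
  near⇒join nr with reach-singles 2≤k nr
  ... | _ , _ , c = S c , length-S c , T c , length-T c
    , Unique-resp-↭ (↭-sym (singles-span c)) (allFin⁺ n)
    , (λ v → ∈-resp-↭ (↭-sym (singles-span c)) (∈-allFin v))
    , All.tabulate (λ s∈ → All.tabulate (singles-independent c s∈))
    , All.tabulate (λ s∈ → All.tabulate (singles-complete c s∈))

  module _ {vs} (walk : Walk G x y vs) (uniq : Unique vs)
    (max : ∀ {ws} → Walk G x y ws → Unique ws → length ws ≤ length vs) where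

    missed : ∃ λ h → h ∉ vs
    missed with any? (λ h → ¬? (h ∈? vs))
    ... | yes p = p
    ... | no ¬p = contradiction (vs , walk , uniq , λ v → decidable-stable (v ∈? vs) (λ v∉ → ¬p (v , v∉))) ¬ham

    h : V
    h = proj₁ missed

    C : V → Set
    C v = ∃ λ ws → Walk G h v ws × All (_∉ vs) ws

    C-step : ∀ {u v} → C u → u ~ v → v ∉ vs → C v
    C-step (ws , w , ps) e v∉ = ws ++ [ _ ] , join w e (here _) , All-++⁺ ps (v∉ ∷ [])

    C-walk : ∀ {u v ws} → C u → Walk G u v ws → All (_∉ vs) ws → ∀ {w} → w ∈ ws → C w
    C-walk c (here _)   _        (here refl) = c
    C-walk c (step _ _) _        (here refl) = c
    C-walk c (step e w) (_ ∷ ps) (there w∈)  = C-walk (C-step c e (All.lookup ps (start∈ w))) w ps w∈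

    -- Go back to `h` and out again, then erase loops; both walks avoid the path.
    connect : ∀ {u w} → C u → C w → ∃ λ us → Walk G u w us × Unique us × (∀ {v} → v ∈ us → C v)
    connect cu@(us , wu , pu) (ws , ww , pw) =
      let l , wl , ⊆l = walk-trans (walk-reverse wu) ww
          r , wr , ur , ⊆r = walk⇒path wl
          outside = λ {v} (v∈ : v ∈ l) →
            [ (λ v∈us → All.lookup pu (∈-resp-↭ (↭-reverse us) v∈us)) , All.lookup pw ]′ (⊆l v∈)
      in r , wr , ur , C-walk cu wr (All.tabulate (outside ∘ ⊆r))

    Att : V → Set
    Att a = ∃ λ w → C w × w ~ a

    join-exists′ : Decidable Att → JoinOf k
    join-exists′ att? = near⇒join (near walk (N.spanning m (N.shape m)))
      where
      module N = Component G kc st {C} {Att} att? (λ c e → _ , c , e) id connect {h} ([ h ] , here h , proj₂ missed ∷ [])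

      closed : ∀ {u w} → C u → u ~ w → C w ⊎ w ∈ vs
      closed {_} {w} c e with w ∈? vs
      ... | yes w∈ = inj₂ w∈
      ... | no w∉  = inj₁ (C-step c e w∉)

      m : N.MaximalPath x y vs
      m = record
        { walk = walk ; uniq = uniq ; x≢y = x≢y ; out = λ (_ , w , ps) → All.lookup ps (end∈ w)
        ; closed = closed ; max = max }

    join-exists : ¬ ¬ JoinOf k
    join-exists ¬join = ¬¬-decidable (¬join ∘ join-exists′)

  -- No longest path is computed. The bound `j` is the room left for longer paths: by induction any
  -- longer path contradicts `¬join`, so the present one may be treated as longest.
  longest : ∀ j {vs} → Walk G x y vs → Unique vs → n ≤ length vs + j → ¬ ¬ JoinOf k
  longest zero    w u le ¬join = join-exists w u (λ _ u′ → ≤-trans (unique-length≤ u′) (≤-trans le (≤-reflexive (+-identityʳ _)))) ¬join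
  longest (suc j) {vs} w u le ¬join = join-exists w u (λ {ws} w′ u′ → ≮⇒≥ λ lt →
    longest j w′ u′ (≤-trans le (≤-trans (≤-reflexive (+-suc (length vs) j)) (+-monoˡ-≤ j lt))) ¬join) ¬join

  join-of : ¬ ¬ JoinOf k
  join-of =
    -- Removing the empty set, which has fewer than `k` vertices, leaves a walk between `x` and `y`.
    let _ , w , _ = proj₂ kc ⊥ (≤-<-trans (≤-reflexive (∣⊥∣≡0 n)) (≤-trans (s≤s z≤n) 2≤k)) x y ∉⊥ ∉⊥
        vs , p , u , _ = walk⇒path w
    in longest n p u (m≤n+m n (length vs))

theorem2 : (k : ℕ) → 2 ≤ k → (n : ℕ) → (G : Graph n) →
    KConnected G k → STGraph G (suc k) 2 →
    HamiltonianConnected G ⊎ (∃ λ (Gk : Graph k) → G ≅ join-kK1 k Gk)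
theorem2 k 2≤k n G kc st with Joins.joinOf? G k
... | yes j = inj₂ (Joins.join-≅ G j)
-- For a graph that is not a join, the lack of a Hamiltonian path is contradictory; since such paths
-- can be searched for, one exists.
... | no ¬j = inj₁ λ x y x≢y → decidable-stable (Graphs.hamiltonianPath? G x y)
  λ ¬ham → NonHamiltonianPair.join-of G 2≤k kc st x≢y ¬ham ¬j
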